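{- Let $A\subseteq\mathbb{N}$ and let $A'$ be the Turing jump of $A$. A partial function $G:\mathbf{2}^*\to\mathbb{Z}$ is partial $A'$-recursive if and only if there exist total $A$-recursive functions $f,g:\mathbf{2}^*\times\mathbb{N}\to\mathbb{N}$ such that, for all $p\in\mathbf{2}^*$, $$G(p)=\max\{f(p,t):t\in\mathbb{N}\}-\max\{g(p,t):t\in\mathbb{N}\}$$ (in particular, $G(p)$ is defined if and only if both maxima are finite).
   Context: $\mathbf{2}^*$ is the set of finite binary words. The maximum of an infinite (unbounded) set of integers is undefined, and a difference is defined iff both terms are. -}

module Defs where

open import Data.Bool using (Bool; true; false)
open import Data.Integer using (ℤ; +_; -[1+_])
open import Data.List using (List; []; _∷_)
open import Data.Maybe as Maybe using (Maybe; just)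
open import Data.Nat using (ℕ; zero; suc; _+_; _*_; _≤_; _<_)
open import Data.Product using (_×_; _,_; ∃; proj₁; proj₂)
open import Data.Sum using (_⊎_)
open import Function.Bundles using (_⇔_)
open import Level using (0ℓ)
open import Relation.Binary.Core using (Rel)
open import Relation.Binary.PropositionalEquality using (_≡_)
open import Relation.Nullary using (¬_)
open import Relation.Unary using (Pred)

triangle : ℕ → ℕ
triangle zero    = 0
triangle (suc n) = suc n + triangle n

-- Cantor's pairing bijection ℕ × ℕ → ℕ and its inverse, which walks along
-- the antidiagonals (s,0), (s-1,1), …, (0,s).
⟨_,_⟩ : ℕ → ℕ → ℕ
⟨ x , y ⟩ = triangle (x + y) + y

next : ℕ × ℕ → ℕ × ℕ
next (zero  , y) = suc y , zero
next (suc x , y) = x , suc y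

unpair : ℕ → ℕ × ℕ
unpair zero    = 0 , 0
unpair (suc n) = next (unpair n)

-- Programs for the partial functions ℕ ⇀ ℕ that are recursive in an oracle:
-- the closure of zero, successor, the two projections of a coded pair, and
-- the characteristic function of the oracle under pairing, composition,
-- primitive recursion and (unbounded) minimisation.  Several arguments are
-- passed as one argument via ⟨_,_⟩.
data Program : Set where
  zero succ left right oracle : Program
  pair comp prec              : Program → Program → Program
  μ                           : Program → Program

-- PrimRec F G a k y:  h(a,k) = y, where h(a,0) = F(a) and
-- h(a,k+1) = G(a,k,h(a,k)), for partial F and G given by their graphs.
PrimRec : Rel ℕ 0ℓ → Rel ℕ 0ℓ → ℕ → ℕ → ℕ → Set
PrimRec F G a zero    y = F a y
PrimRec F G a (suc k) y = ∃ λ z → PrimRec F G a k z × G ⟨ a , ⟨ k , z ⟩ ⟩ y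

-- ⟦ c ⟧ A x y:  program c with oracle A halts on input x with output y.
-- Strictness is built in: a compound program halts only if all the
-- computations it calls for do; in particular the search performed by μ c
-- reaches y only if c halts, with nonzero output, on every i < y.
⟦_⟧ : Program → Pred ℕ 0ℓ → Rel ℕ 0ℓ
⟦ zero     ⟧ A x y = y ≡ 0
⟦ succ     ⟧ A x y = y ≡ suc x
⟦ left     ⟧ A x y = y ≡ proj₁ (unpair x)
⟦ right    ⟧ A x y = y ≡ proj₂ (unpair x)
⟦ oracle   ⟧ A x y = (A x × y ≡ 1) ⊎ (¬ A x × y ≡ 0)
⟦ pair c d ⟧ A x y = ∃ λ u → ∃ λ v → ⟦ c ⟧ A x u × ⟦ d ⟧ A x v × y ≡ ⟨ u , v ⟩
⟦ comp c d ⟧ A x y = ∃ λ z → ⟦ d ⟧ A x z × ⟦ c ⟧ A z y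
⟦ prec c d ⟧ A x y =
  PrimRec (⟦ c ⟧ A) (⟦ d ⟧ A) (proj₁ (unpair x)) (proj₂ (unpair x)) y
⟦ μ c      ⟧ A x y =
  ⟦ c ⟧ A ⟨ x , y ⟩ 0 × (∀ i → i < y → ∃ λ k → ⟦ c ⟧ A ⟨ x , i ⟩ (suc k))

-- Gödel numbering.  It is injective; the numbers outside its range are
-- regarded as indices of the nowhere defined function.
⌜_⌝ : Program → ℕ
⌜ zero     ⌝ = ⟨ 0 , 0 ⟩
⌜ succ     ⌝ = ⟨ 1 , 0 ⟩
⌜ left     ⌝ = ⟨ 2 , 0 ⟩
⌜ right    ⌝ = ⟨ 3 , 0 ⟩
⌜ oracle   ⌝ = ⟨ 4 , 0 ⟩
⌜ pair c d ⌝ = ⟨ 5 , ⟨ ⌜ c ⌝ , ⌜ d ⌝ ⟩ ⟩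
⌜ comp c d ⌝ = ⟨ 6 , ⟨ ⌜ c ⌝ , ⌜ d ⌝ ⟩ ⟩
⌜ prec c d ⌝ = ⟨ 7 , ⟨ ⌜ c ⌝ , ⌜ d ⌝ ⟩ ⟩
⌜ μ c      ⌝ = ⟨ 8 , ⌜ c ⌝ ⟩

-- The Turing jump: the set of e such that the e-th program with oracle A
-- halts on input e.
infix 9 _′
_′ : Pred ℕ 0ℓ → Pred ℕ 0ℓ
(A ′) e = ∃ λ c → ⌜ c ⌝ ≡ e × ∃ λ y → ⟦ c ⟧ A e y

Word : Set
Word = List Bool

-- Bijective base-2 numeration, with digits 1 (false) and 2 (true).
codeWord : Word → ℕ
codeWord []          = 0
codeWord (false ∷ p) = 1 + 2 * codeWord p
codeWord (true  ∷ p) = 2 + 2 * codeWord p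

-- The bijection 0, -1, 1, -2, 2, … ↦ 0, 1, 2, 3, 4, …
codeℤ : ℤ → ℕ
codeℤ (+ n)    = 2 * n
codeℤ -[1+ n ] = 1 + 2 * n

-- A partial function is a Maybe-valued one, undefined where it is nothing.
-- Since y is arbitrary, the program diverges exactly where G is undefined.
PartialRecursiveIn : Pred ℕ 0ℓ → (Word → Maybe ℤ) → Set
PartialRecursiveIn A G =
  ∃ λ c → ∀ p y → ⟦ c ⟧ A (codeWord p) y ⇔ (Maybe.map codeℤ (G p) ≡ just y)

TotalRecursiveIn : Pred ℕ 0ℓ → (Word × ℕ → ℕ) → Set
TotalRecursiveIn A f =
  ∃ λ c → ∀ p t y → ⟦ c ⟧ A ⟨ codeWord p , t ⟩ y ⇔ (f (p , t) ≡ y)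

-- m = max { h t : t ∈ ℕ }; no such m exists when h is unbounded.
IsMax : (ℕ → ℕ) → ℕ → Set
IsMax h m = (∃ λ t → h t ≡ m) × (∀ t → h t ≤ m)

{-# OPTIONS --safe #-}
-- From right to left, the maximum of f(p,-) is the least m such that no t has
-- f(p,t) > m, and each of these questions is the halting of a program with oracle
-- A, hence a query to A′.
--
-- From left to right, a computation with oracle A′ is certified by a finite list of
-- facts "program c halts on x with output y", each justified by later entries.
-- Positive answers of A′ in the list have witnesses, negative ones have to
-- withstand every stage t, so the graph of a partial A′-recursive function is
-- { (x , y) : ∃ w ∀ t S(x,w,t,y) } with S recursive in A.  Run through the
-- candidates w, which encode the output as a difference a(w) - b(w), and let
-- f(p,-) and g(p,-) attain w * w + a(w) and w * w + b(w) as soon as all smaller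
-- candidates have been refuted.  Since a(w), b(w) ≤ w these values increase with w:
-- they are largest at the least w that is never refuted, and they are unbounded
-- if there is none.

module Submission where

open import Defs
open import Axiom.ExcludedMiddle using (ExcludedMiddle)
open import Data.Bool using (Bool; true; false; if_then_else_)
open import Data.Empty using (⊥; ⊥-elim)
open import Data.Fin using (Fin; zero; suc)
open import Data.Fin.Patterns using (0F; 1F; 2F; 3F)
open import Data.Integer using (ℤ; +_; _-_; -[1+_]; _⊖_)
import Data.Integer.Properties as ℤ
open import Data.List as List using (List; []; _∷_; _++_; length)
open import Data.List.Membership.Propositional using (_∈_)
open import Data.List.Membership.Propositional.Properties using (∈-++⁺ˡ; ∈-++⁺ʳ)
open import Data.List.Relation.Unary.Any using (here; there)
open import Data.Maybe as Maybe using (Maybe; just)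
open import Data.Maybe.Properties using (map-injective)
open import Data.Nat using (ℕ; zero; suc; pred; _+_; _*_; _∸_; _≤_; _<_; z≤n; s≤s; z<s; s<s; _≤?_)
open import Data.Nat.Properties
open import Data.Product using (_×_; _,_; ∃; Σ; proj₁; proj₂)
open import Data.Sum as Sum using (_⊎_; inj₁; inj₂; [_,_]′)
open import Data.Vec using (Vec; []; _∷_; head; tail)
open import Function using (_∘_; id)
open import Function.Bundles using (_⇔_; mk⇔; Equivalence)
open import Level using (0ℓ)
open import Relation.Binary.Definitions using (tri<; tri≈; tri>)
open import Relation.Binary.PropositionalEquality hiding ([_])
open import Relation.Nullary using (¬_; Dec; yes; no; does)
open import Relation.Nullary.Decidable using (map′; decidable-stable)
open import Relation.Unary using (Pred; Decidable)

open Equivalence using (to; from)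

-- Cantor pairing and its projections

π₁ π₂ : ℕ → ℕ
π₁ n = proj₁ (unpair n)
π₂ n = proj₂ (unpair n)

⟨⟩-next : ∀ x y → ⟨ proj₁ (next (x , y)) , proj₂ (next (x , y)) ⟩ ≡ suc ⟨ x , y ⟩
⟨⟩-next zero y = begin
  triangle (suc y + 0) + 0  ≡⟨ +-identityʳ _ ⟩
  triangle (suc y + 0)      ≡⟨ cong triangle (+-identityʳ (suc y)) ⟩
  suc y + triangle y        ≡⟨ cong suc (+-comm y (triangle y)) ⟩
  suc (triangle y + y)      ∎
  where open ≡-Reasoning
⟨⟩-next (suc x) y = begin
  triangle (x + suc y) + suc y    ≡⟨ +-suc _ y ⟩
  suc (triangle (x + suc y) + y)  ≡⟨ cong (λ s → suc (triangle s + y)) (+-suc x y) ⟩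
  suc (triangle (suc x + y) + y)  ∎
  where open ≡-Reasoning

⟨π₁,π₂⟩ : ∀ n → ⟨ π₁ n , π₂ n ⟩ ≡ n
⟨π₁,π₂⟩ zero    = refl
⟨π₁,π₂⟩ (suc n) = trans (⟨⟩-next (π₁ n) (π₂ n)) (cong suc (⟨π₁,π₂⟩ n))

-- Induction along the walk of `unpair`: on the antidiagonal s and, within it, on y. The start of an
-- antidiagonal is reached from the end of the previous one.
unpair-⟨⟩ : ∀ x y → unpair ⟨ x , y ⟩ ≡ (x , y)
unpair-⟨⟩ x y = along (x + y) x y refl
  where
  step : ∀ x y → unpair ⟨ x , y ⟩ ≡ (x , y) →
         unpair ⟨ proj₁ (next (x , y)) , proj₂ (next (x , y)) ⟩ ≡ next (x , y)
  step x y eq = trans (cong unpair (⟨⟩-next x y)) (cong next eq)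

  along : ∀ s x y → x + y ≡ s → unpair ⟨ x , y ⟩ ≡ (x , y)
  along s       zero    zero    eq   = refl
  along (suc s) (suc x) zero    eq   =
    step zero x (along s zero x (trans (sym (+-identityʳ x)) (suc-injective eq)))
  along s       x       (suc y) eq   =
    step (suc x) y (along s (suc x) y (trans (sym (+-suc x y)) eq))

π₁-⟨⟩ : ∀ x y → π₁ ⟨ x , y ⟩ ≡ x
π₁-⟨⟩ x y = cong proj₁ (unpair-⟨⟩ x y)

π₂-⟨⟩ : ∀ x y → π₂ ⟨ x , y ⟩ ≡ y
π₂-⟨⟩ x y = cong proj₂ (unpair-⟨⟩ x y)

x+y≤⟨x,y⟩ : ∀ x y → x + y ≤ ⟨ x , y ⟩
x+y≤⟨x,y⟩ x y = ≤-trans (n≤triangle (x + y)) (m≤m+n _ y)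
  where
  n≤triangle : ∀ n → n ≤ triangle n
  n≤triangle zero    = z≤n
  n≤triangle (suc n) = m≤m+n (suc n) _

π₁+π₂≤ : ∀ n → π₁ n + π₂ n ≤ n
π₁+π₂≤ n = subst (π₁ n + π₂ n ≤_) (⟨π₁,π₂⟩ n) (x+y≤⟨x,y⟩ (π₁ n) (π₂ n))

π₁≤ : ∀ n → π₁ n ≤ n
π₁≤ n = ≤-trans (m≤m+n _ _) (π₁+π₂≤ n)

π₂≤ : ∀ n → π₂ n ≤ n
π₂≤ n = ≤-trans (m≤n+m _ _) (π₁+π₂≤ n)

⟨⟩-injective : ∀ {x y u v} → ⟨ x , y ⟩ ≡ ⟨ u , v ⟩ → x ≡ u × y ≡ v
⟨⟩-injective {x} {y} {u} {v} eq =
  trans (sym (π₁-⟨⟩ x y)) (trans (cong π₁ eq) (π₁-⟨⟩ u v)) ,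
  trans (sym (π₂-⟨⟩ x y)) (trans (cong π₂ eq) (π₂-⟨⟩ u v))

-- Injectivity of the Gödel numbering

tag arg : Program → ℕ
tag zero       = 0
tag succ       = 1
tag left       = 2
tag right      = 3
tag oracle     = 4
tag (pair _ _) = 5
tag (comp _ _) = 6
tag (prec _ _) = 7
tag (μ _)      = 8
arg zero       = 0
arg succ       = 0
arg left       = 0
arg right      = 0
arg oracle     = 0
arg (pair c d) = ⟨ ⌜ c ⌝ , ⌜ d ⌝ ⟩
arg (comp c d) = ⟨ ⌜ c ⌝ , ⌜ d ⌝ ⟩
arg (prec c d) = ⟨ ⌜ c ⌝ , ⌜ d ⌝ ⟩
arg (μ c)      = ⌜ c ⌝

⌜⌝-tag-arg : ∀ c → ⌜ c ⌝ ≡ ⟨ tag c , arg c ⟩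
⌜⌝-tag-arg zero       = refl
⌜⌝-tag-arg succ       = refl
⌜⌝-tag-arg left       = refl
⌜⌝-tag-arg right      = refl
⌜⌝-tag-arg oracle     = refl
⌜⌝-tag-arg (pair c d) = refl
⌜⌝-tag-arg (comp c d) = refl
⌜⌝-tag-arg (prec c d) = refl
⌜⌝-tag-arg (μ c)      = refl

mutual
  ⌜⌝-injective : ∀ c d → ⌜ c ⌝ ≡ ⌜ d ⌝ → c ≡ d
  ⌜⌝-injective c d eq =
    let tags , args = ⟨⟩-injective (trans (sym (⌜⌝-tag-arg c)) (trans eq (⌜⌝-tag-arg d)))
    in  tag-arg-injective c d tags args

  -- Matching the equation between the tags against `refl` rules out different constructors, so only
  -- the nine diagonal cases are left.
  tag-arg-injective : ∀ c d → tag c ≡ tag d → arg c ≡ arg d → c ≡ d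
  tag-arg-injective zero       zero       refl _  = refl
  tag-arg-injective succ       succ       refl _  = refl
  tag-arg-injective left       left       refl _  = refl
  tag-arg-injective right      right      refl _  = refl
  tag-arg-injective oracle     oracle     refl _  = refl
  tag-arg-injective (pair c d) (pair e f) refl eq =
    let p , q = ⟨⟩-injective eq in cong₂ pair (⌜⌝-injective c e p) (⌜⌝-injective d f q)
  tag-arg-injective (comp c d) (comp e f) refl eq =
    let p , q = ⟨⟩-injective eq in cong₂ comp (⌜⌝-injective c e p) (⌜⌝-injective d f q)
  tag-arg-injective (prec c d) (prec e f) refl eq =
    let p , q = ⟨⟩-injective eq in cong₂ prec (⌜⌝-injective c e p) (⌜⌝-injective d f q)
  tag-arg-injective (μ c)      (μ e)      refl eq = cong μ (⌜⌝-injective c e eq)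

-- Determinism of programs

module _ {B : Pred ℕ 0ℓ} where

  deterministic : ∀ c {x y z} → ⟦ c ⟧ B x y → ⟦ c ⟧ B x z → y ≡ z
  deterministic-prec : ∀ c d a k {y z} →
    PrimRec (⟦ c ⟧ B) (⟦ d ⟧ B) a k y → PrimRec (⟦ c ⟧ B) (⟦ d ⟧ B) a k z → y ≡ z

  deterministic zero   p q = trans p (sym q)
  deterministic succ   p q = trans p (sym q)
  deterministic left   p q = trans p (sym q)
  deterministic right  p q = trans p (sym q)
  deterministic oracle (inj₁ (_ , p)) (inj₁ (_ , q)) = trans p (sym q)
  deterministic oracle (inj₁ (b , _)) (inj₂ (¬b , _)) = ⊥-elim (¬b b)
  deterministic oracle (inj₂ (¬b , _)) (inj₁ (b , _)) = ⊥-elim (¬b b)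
  deterministic oracle (inj₂ (_ , p)) (inj₂ (_ , q)) = trans p (sym q)
  deterministic (pair c d) (_ , _ , p , q , r) (_ , _ , p′ , q′ , r′) =
    trans r (trans (cong₂ ⟨_,_⟩ (deterministic c p p′) (deterministic d q q′)) (sym r′))
  deterministic (comp c d) (_ , p , q) (_ , p′ , q′)
    with refl ← deterministic d p p′ = deterministic c q q′
  deterministic (prec c d) {x} p q = deterministic-prec c d (π₁ x) (π₂ x) p q
  deterministic (μ c) {x} {y} {z} (p , below) (q , below′) with <-cmp y z
  ... | tri≈ _ y≡z _ = y≡z
  ... | tri< y<z _ _ = ⊥-elim (0≢1+n (deterministic c p (proj₂ (below′ y y<z))))
  ... | tri> _ _ z<y = ⊥-elim (0≢1+n (deterministic c q (proj₂ (below z z<y))))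

  deterministic-prec c d a zero    p q = deterministic c p q
  deterministic-prec c d a (suc k) (_ , p , q) (_ , p′ , q′)
    with refl ← deterministic-prec c d a k p p′ = deterministic d q q′

-- Case tables and basic programs

select : List Set → ℕ → Set
select []       _       = ⊥
select (P ∷ Ps) zero    = P
select (P ∷ Ps) (suc n) = select Ps n

ifZero : ℕ → ℕ → ℕ → ℕ
ifZero zero    x y = x
ifZero (suc _) x y = y

identity : Program
identity = pair left right

numeral : ℕ → Program
numeral zero    = zero
numeral (suc k) = comp succ (numeral k)

-- A conditional made from primitive recursion on the output of `c`: the base is `e`, and each step
-- discards the previous result and runs `d` on the original input. Nonzero thus selects `d`.
branch : Program → Program → Program → Program
branch c d e = comp (prec e (comp d left)) (pair identity c)

env : ∀ {n} → Vec ℕ n → ℕ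
env []      = 0
env (x ∷ ρ) = ⟨ x , env ρ ⟩

-- The semantics as a record: unlike ⟦_⟧ it does not compute, so that
-- programs and inputs are inferred from the types of derivations.
infix 4 _⊢_∶_↦_
record _⊢_∶_↦_ (B : Pred ℕ 0ℓ) (c : Program) (x y : ℕ) : Set where
  constructor run
  field
    halts : ⟦ c ⟧ B x y

open _⊢_∶_↦_

module _ {B : Pred ℕ 0ℓ} where

  infixr 9 _⨾_
  _⨾_ : ∀ {c d x y z} → B ⊢ d ∶ x ↦ z → B ⊢ c ∶ z ↦ y → B ⊢ comp c d ∶ x ↦ y
  p ⨾ q = run (_ , halts p , halts q)

  infixr 8 _,ʳ_
  _,ʳ_ : ∀ {c d x y z} → B ⊢ c ∶ x ↦ y → B ⊢ d ∶ x ↦ z → B ⊢ pair c d ∶ x ↦ ⟨ y , z ⟩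
  p ,ʳ q = run (_ , _ , halts p , halts q , refl)

  runs-identity : ∀ x → B ⊢ identity ∶ x ↦ x
  runs-identity x = run (_ , _ , refl , refl , sym (⟨π₁,π₂⟩ x))

  runs-numeral : ∀ k x → B ⊢ numeral k ∶ x ↦ k
  runs-numeral zero    x = run refl
  runs-numeral (suc k) x = runs-numeral k x ⨾ run refl

  runs-left : ∀ x y → B ⊢ left ∶ ⟨ x , y ⟩ ↦ x
  runs-left x y = run (sym (π₁-⟨⟩ x y))

  runs-right : ∀ x y → B ⊢ right ∶ ⟨ x , y ⟩ ↦ y
  runs-right x y = run (sym (π₂-⟨⟩ x y))

  runs-prec : ∀ {c d} a k {y} → PrimRec (⟦ c ⟧ B) (⟦ d ⟧ B) a k y → B ⊢ prec c d ∶ ⟨ a , k ⟩ ↦ y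
  runs-prec {c} {d} a k {y} p = run
    (subst (λ (a′ , k′) → PrimRec (⟦ c ⟧ B) (⟦ d ⟧ B) a′ k′ y) (sym (unpair-⟨⟩ a k)) p)

  runs-branch : ∀ {c d e x k u v} → B ⊢ c ∶ x ↦ k → B ⊢ d ∶ x ↦ u → B ⊢ e ∶ x ↦ v →
                B ⊢ branch c d e ∶ x ↦ ifZero k v u
  runs-branch {c} {d} {e} {x} {k} {u} {v} p q r =
    (runs-identity x ,ʳ p) ⨾ runs-prec x k (recursion k)
    where
    recursion : ∀ k → PrimRec (⟦ e ⟧ B) (⟦ comp d left ⟧ B) x k (ifZero k v u)
    recursion zero    = halts r
    recursion (suc k) = _ , recursion k , halts (runs-left x _ ⨾ q)

-- A-recursive functions and relations as terms and formulas

module Recursive {A : Pred ℕ 0ℓ} (A? : Decidable A) where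

  -- Total A-recursive functions of n arguments.  The name refers to their use as
  -- the terms of a language, with de Bruijn indices for the bound variables.
  record Term (n : ℕ) : Set where
    constructor term
    field
      val  : Vec ℕ n → ℕ
      code : Program
      runs : ∀ ρ → A ⊢ code ∶ env ρ ↦ val ρ

  open Term public

  -- Keeps the program but replaces the function, so that `val` of a derived operation unfolds to
  -- the intended function rather than to its recursion.
  as : ∀ {n} (t : Term n) (f : Vec ℕ n → ℕ) → (∀ ρ → val t ρ ≡ f ρ) → Term n
  as t f eq = term f (code t) λ ρ → subst (A ⊢ code t ∶ env ρ ↦_) (eq ρ) (runs t ρ)

  var : ∀ {n} → Fin n → Term n
  var zero    = term head left λ where (x ∷ ρ) → runs-left x (env ρ)
  var (suc i) = term (λ ρ → val (var i) (tail ρ)) (comp (code (var i)) right) λ where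
    (x ∷ ρ) → runs-right x (env ρ) ⨾ runs (var i) ρ

  infix 30 ↑_
  ↑_ : ∀ {n} → Term n → Term (suc n)
  ↑ t = term (val t ∘ tail) (comp (code t) right) λ where
    (x ∷ ρ) → runs-right x (env ρ) ⨾ runs t ρ

  apply : ∀ {n} c (f : ℕ → ℕ) → (∀ x → A ⊢ c ∶ x ↦ f x) → Term n → Term n
  apply c f runs-f t = term (f ∘ val t) (comp c (code t)) λ ρ → runs t ρ ⨾ runs-f (val t ρ)

  sucᵗ π₁ᵗ π₂ᵗ : ∀ {n} → Term n → Term n
  sucᵗ = apply succ suc (λ _ → run refl)
  π₁ᵗ  = apply left π₁ (λ _ → run refl)
  π₂ᵗ  = apply right π₂ (λ _ → run refl)

  # : ∀ {n} → ℕ → Term n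
  # k = term (λ _ → k) (numeral k) (runs-numeral k ∘ env)

  ⟨_,_⟩ᵗ : ∀ {n} → Term n → Term n → Term n
  ⟨ t , u ⟩ᵗ = term (λ ρ → ⟨ val t ρ , val u ρ ⟩) (pair (code t) (code u)) λ ρ →
    runs t ρ ,ʳ runs u ρ

  iterate : ∀ {n} → (Vec ℕ n → ℕ) → (Vec ℕ (2 + n) → ℕ) → Vec ℕ n → ℕ → ℕ
  iterate f g ρ zero    = f ρ
  iterate f g ρ (suc k) = g (k ∷ iterate f g ρ k ∷ ρ)

  -- `prec` hands its step the input `⟨ a , ⟨ k , z ⟩ ⟩`, while a term with two more variables
  -- expects k and z in front of the environment a.
  rearrange : Program
  rearrange = pair (comp left right) (pair (comp right right) left)

  runs-rearrange : ∀ a k z → A ⊢ rearrange ∶ ⟨ a , ⟨ k , z ⟩ ⟩ ↦ ⟨ k , ⟨ z , a ⟩ ⟩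
  runs-rearrange a k z =
    (runs-right a ⟨ k , z ⟩ ⨾ runs-left k z) ,ʳ
    (runs-right a ⟨ k , z ⟩ ⨾ runs-right k z) ,ʳ
    runs-left a ⟨ k , z ⟩

  rec : ∀ {n} → Term n → Term (2 + n) → Term n → Term n
  rec t u v = term (λ ρ → iterate (val t) (val u) ρ (val v ρ))
    (comp (prec (code t) (comp (code u) rearrange)) (pair identity (code v))) λ ρ →
    (runs-identity (env ρ) ,ʳ runs v ρ) ⨾ runs-prec (env ρ) (val v ρ) (recursion ρ (val v ρ))
    where
    recursion : ∀ ρ k → PrimRec (⟦ code t ⟧ A) (⟦ comp (code u) rearrange ⟧ A) (env ρ) k
                                (iterate (val t) (val u) ρ k)
    recursion ρ zero    = halts (runs t ρ)
    recursion ρ (suc k) = _ , recursion ρ k ,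
      halts (runs-rearrange (env ρ) k _ ⨾ runs u (k ∷ _ ∷ ρ))

  vals : ∀ {n m} → Vec (Term n) m → Vec ℕ n → Vec ℕ m
  vals []       ρ = []
  vals (t ∷ ts) ρ = val t ρ ∷ vals ts ρ

  codes : ∀ {n m} → Vec (Term n) m → Program
  codes []       = zero
  codes (t ∷ ts) = pair (code t) (codes ts)

  runs-codes : ∀ {n m} (ts : Vec (Term n) m) ρ → A ⊢ codes ts ∶ env ρ ↦ env (vals ts ρ)
  runs-codes []       ρ = run refl
  runs-codes (t ∷ ts) ρ = runs t ρ ,ʳ runs-codes ts ρ

  predᵗ : ∀ {n} → Term n → Term n
  predᵗ t = as (rec (# 0) (var 0F) t) (pred ∘ val t) λ ρ → eq ρ (val t ρ)
    where
    eq : ∀ ρ k → iterate (λ _ → 0) head ρ k ≡ pred k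
    eq ρ zero    = refl
    eq ρ (suc k) = refl

  infixl 25 _+ᵗ_ _∸ᵗ_
  infixl 26 _*ᵗ_
  _+ᵗ_ _∸ᵗ_ _*ᵗ_ : ∀ {n} → Term n → Term n → Term n
  t +ᵗ u = as (rec t (sucᵗ (var 1F)) u) (λ ρ → val t ρ + val u ρ) λ ρ → eq ρ (val u ρ)
    where
    eq : ∀ ρ k → iterate (val t) (val (sucᵗ (var 1F))) ρ k ≡ val t ρ + k
    eq ρ zero    = sym (+-identityʳ _)
    eq ρ (suc k) = trans (cong suc (eq ρ k)) (sym (+-suc _ k))
  t ∸ᵗ u = as (rec t (predᵗ (var 1F)) u) (λ ρ → val t ρ ∸ val u ρ) λ ρ → eq ρ (val u ρ)
    where
    eq : ∀ ρ k → iterate (val t) (val (predᵗ (var 1F))) ρ k ≡ val t ρ ∸ k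
    eq ρ zero    = refl
    eq ρ (suc k) = trans (cong pred (eq ρ k)) (pred[m∸n]≡m∸[1+n] (val t ρ) k)
  t *ᵗ u = as (rec (# 0) (↑ ↑ t +ᵗ var 1F) u) (λ ρ → val t ρ * val u ρ) λ ρ → eq ρ (val u ρ)
    where
    eq : ∀ ρ k → iterate (val (# 0)) (val (↑ ↑ t +ᵗ var 1F)) ρ k ≡ val t ρ * k
    eq ρ zero    = sym (*-zeroʳ (val t ρ))
    eq ρ (suc k) = trans (cong (λ z → val t ρ + z) (eq ρ k)) (sym (*-suc (val t ρ) k))

  bit : Bool → ℕ
  bit b = if b then 1 else 0

  -- A-recursive n-ary relations.
  record Formula (n : ℕ) : Set₁ where
    constructor formula
    field
      holds   : Vec ℕ n → Set
      program : Program
      decides : ∀ ρ → Σ (Dec (holds ρ)) λ d → A ⊢ program ∶ env ρ ↦ bit (does d)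

    holds? : ∀ ρ → Dec (holds ρ)
    holds? ρ = proj₁ (decides ρ)

  open Formula public

  asᶠ : ∀ {n} (φ : Formula n) (P : Vec ℕ n → Set) →
        (∀ ρ → holds φ ρ → P ρ) → (∀ ρ → P ρ → holds φ ρ) → Formula n
  asᶠ φ P f g = formula P (program φ) λ ρ →
    map′ (f ρ) (g ρ) (holds? φ ρ) , proj₂ (decides φ ρ)

  infix 28 _[_]
  _[_] : ∀ {n m} → Formula m → Vec (Term n) m → Formula n
  φ [ ts ] = formula (holds φ ∘ vals ts) (comp (program φ) (codes ts)) λ ρ →
    holds? φ (vals ts ρ) , runs-codes ts ρ ⨾ proj₂ (decides φ (vals ts ρ))

  oracleᶠ : ∀ {n} → Term n → Formula n
  oracleᶠ t = formula (A ∘ val t) (comp oracle (code t)) λ ρ →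
    let d , p = answer (val t ρ) in d , runs t ρ ⨾ p
    where
    answer : ∀ x → Σ (Dec (A x)) λ d → A ⊢ oracle ∶ x ↦ bit (does d)
    answer x with A? x
    ... | yes a = yes a , run (inj₁ (a , refl))
    ... | no ¬a = no ¬a , run (inj₂ (¬a , refl))

  infix 24 _≤ᶠ_ _<ᶠ_ _≡ᶠ_
  infixr 22 _∧_
  infixr 21 _∨_
  infixr 20 _⇒_

  _≤ᶠ_ _<ᶠ_ _≡ᶠ_ : ∀ {n} → Term n → Term n → Formula n
  t ≤ᶠ u = formula (λ ρ → val t ρ ≤ val u ρ) (branch (code (t ∸ᵗ u)) zero (numeral 1)) λ ρ →
    let d , eq = difference (val t ρ) (val u ρ)
    in  d , subst (A ⊢ _ ∶ env ρ ↦_) eq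
              (runs-branch (runs (t ∸ᵗ u) ρ) (run refl) (runs-numeral 1 (env ρ)))
    where
    difference : ∀ x y → Σ (Dec (x ≤ y)) λ d → ifZero (x ∸ y) 1 0 ≡ bit (does d)
    difference x y with x ∸ y in eq
    ... | zero  = yes (m∸n≡0⇒m≤n eq) , refl
    ... | suc k = no (λ x≤y → 0≢1+n (trans (sym (m≤n⇒m∸n≡0 x≤y)) eq)) , refl
  t <ᶠ u = sucᵗ t ≤ᶠ u

  ⊥ᶠ : ∀ {n} → Formula n
  ⊥ᶠ = formula (λ _ → ⊥) zero λ _ → no id , run refl

  -- Conjunction and disjunction are defined from implication and falsity. Formulas are decidable,
  -- so `asᶠ` can give them their usual constructive meaning.
  _⇒_ _∧_ _∨_ : ∀ {n} → Formula n → Formula n → Formula n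
  φ ⇒ ψ = formula (λ ρ → holds φ ρ → holds ψ ρ)
    (branch (program φ) (program ψ) (numeral 1)) λ ρ →
    let d , eq = truth (holds? φ ρ) (holds? ψ ρ)
    in  d , subst (A ⊢ _ ∶ env ρ ↦_) eq
              (runs-branch (proj₂ (decides φ ρ)) (proj₂ (decides ψ ρ)) (runs-numeral 1 (env ρ)))
    where
    truth : ∀ {P Q : Set} (p : Dec P) (q : Dec Q) → Σ (Dec (P → Q)) λ d →
            ifZero (bit (does p)) 1 (bit (does q)) ≡ bit (does d)
    truth (yes p) (yes q) = yes (λ _ → q) , refl
    truth (yes p) (no ¬q) = no (λ f → ¬q (f p)) , refl
    truth (no ¬p) _       = yes (⊥-elim ∘ ¬p) , refl

  infix 23 ~_
  ~_ : ∀ {n} → Formula n → Formula n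
  ~ φ = φ ⇒ ⊥ᶠ

  φ ∧ ψ = asᶠ (~ (φ ⇒ ~ ψ)) (λ ρ → holds φ ρ × holds ψ ρ)
    (λ ρ h → decidable-stable (holds? φ ρ) (λ ¬p → h (λ p → ⊥-elim (¬p p))) ,
             decidable-stable (holds? ψ ρ) (λ ¬q → h (λ _ → ¬q)))
    (λ ρ (p , q) h → h p q)

  φ ∨ ψ = asᶠ (~ φ ⇒ ψ) (λ ρ → holds φ ρ ⊎ holds ψ ρ)
    (λ ρ h → case (holds? φ ρ) h)
    (λ ρ → [ (λ p ¬p → ⊥-elim (¬p p)) , (λ q _ → q) ]′)
    where
    case : ∀ {P Q : Set} → Dec P → (¬ P → Q) → P ⊎ Q
    case (yes p) h = inj₁ p
    case (no ¬p) h = inj₂ (h ¬p)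

  t ≡ᶠ u = asᶠ (t ≤ᶠ u ∧ u ≤ᶠ t) (λ ρ → val t ρ ≡ val u ρ)
    (λ ρ (p , q) → ≤-antisym p q) (λ ρ eq → ≤-reflexive eq , ≤-reflexive (sym eq))

  -- The universal quantifier is a primitive recursion that starts at 1 and drops to 0 once `φ`
  -- fails; the existential one is its dual.
  all< any< : ∀ {n} → Term n → Formula (suc n) → Formula n
  all< {n} t φ = formula (λ ρ → ∀ i → i < val t ρ → holds φ (i ∷ ρ))
    (code (rec (# 1) body t)) λ ρ →
    let d , eq = truth ρ (val t ρ)
    in  d , subst (A ⊢ _ ∶ env ρ ↦_) eq (runs (rec (# 1) body t) ρ)
    where
    -- Removes the intermediate result z, since `φ` speaks of i and the environment only.
    drop₁ : Program
    drop₁ = pair left (comp right right)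

    step : ∀ {P : Set} → Dec P → ℕ → ℕ
    step p z = ifZero (bit (does p)) 0 z

    body : Term (2 + n)
    body = term (λ where (i ∷ z ∷ ρ) → step (holds? φ (i ∷ ρ)) z)
      (branch (comp (program φ) drop₁) (comp left right) zero) λ where
        (i ∷ z ∷ ρ) →
          let rest = runs-right i ⟨ z , env ρ ⟩
          in  runs-branch
                ((runs-left i ⟨ z , env ρ ⟩ ,ʳ (rest ⨾ runs-right z (env ρ)))
                  ⨾ proj₂ (decides φ (i ∷ ρ)))
                (rest ⨾ runs-left z (env ρ))
                (run refl)

    extend : ∀ {P : ℕ → Set} {k z} → Dec (P k) →
             (p : Dec (P k)) (q : Dec (∀ i → i < k → P i)) → z ≡ bit (does q) →
             Σ (Dec (∀ i → i < suc k → P i)) λ d → step p z ≡ bit (does d)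
    extend {P} _ (yes p) (yes q) eq = yes below , eq
      where
      below : ∀ i → i < suc _ → P i
      below i i<1+k with m<1+n⇒m<n∨m≡n i<1+k
      ... | inj₁ i<k  = q i i<k
      ... | inj₂ refl = p
    extend _ (yes p) (no ¬q) eq = no (λ h → ¬q (λ i i<k → h i (m<n⇒m<1+n i<k))) , eq
    extend _ (no ¬p) _       eq = no (λ h → ¬p (h _ ≤-refl)) , refl

    truth : ∀ ρ k → Σ (Dec (∀ i → i < k → holds φ (i ∷ ρ))) λ d →
            iterate (val (# 1)) (val body) ρ k ≡ bit (does d)
    truth ρ zero    = yes (λ _ ()) , refl
    truth ρ (suc k) = let q , eq = truth ρ k in extend (holds? φ (k ∷ ρ)) (holds? φ (k ∷ ρ)) q eq

  any< t φ = asᶠ (~ (all< t (~ φ))) (λ ρ → ∃ λ i → i < val t ρ × holds φ (i ∷ ρ))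
    (λ ρ h → decidable-stable (anyUpTo? (λ i → holds? φ (i ∷ ρ)) (val t ρ))
      (λ none → h (λ i i<t p → none (i , i<t , p))))
    (λ ρ (i , i<t , p) h → h i i<t p)

  holdAll : ∀ {n} → List (Formula n) → Vec ℕ n → List Set
  holdAll φs ρ = List.map (λ φ → holds φ ρ) φs

  select-case : ∀ {P Ps} n → ((n ≡ 0 → P) × (¬ (n ≡ 0) → select Ps (pred n))) → select (P ∷ Ps) n
  select-case zero    (p , _) = p refl
  select-case (suc n) (_ , q) = q (λ ())

  case-select : ∀ {P Ps} n → select (P ∷ Ps) n → (n ≡ 0 → P) × (¬ (n ≡ 0) → select Ps (pred n))
  case-select zero    p = (λ _ → p) , (λ n≢0 → ⊥-elim (n≢0 refl))
  case-select (suc n) q = (λ ()) , (λ _ → q)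

  -- The counterpart of `select` for formulas. Because of `asᶠ`, on an explicit list `holds` unfolds
  -- to the corresponding `select`, so a table of formulas has literally the meaning of the same
  -- table of sets.
  switch : ∀ {n} → Term n → List (Formula n) → Formula n
  switch-holds : ∀ {n} (t : Term n) φs ρ →
                 holds (switch t φs) ρ ≡ select (holdAll φs ρ) (val t ρ)

  switch t []       = ⊥ᶠ
  switch t (φ ∷ φs) = asᶠ ((t ≡ᶠ # 0 ⇒ φ) ∧ (~ (t ≡ᶠ # 0) ⇒ switch (predᵗ t) φs))
    (λ ρ → select (holdAll (φ ∷ φs) ρ) (val t ρ))
    (λ ρ (p , q) → select-case (val t ρ)
      (p , subst id (switch-holds (predᵗ t) φs ρ) ∘ q))
    (λ ρ h → let p , q = case-select (val t ρ) h
             in  p , subst id (sym (switch-holds (predᵗ t) φs ρ)) ∘ q)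

  switch-holds t []       ρ = refl
  switch-holds t (φ ∷ φs) ρ = refl

  ifᵗ : ∀ {n} → Formula n → Term n → Term n → Term n
  ifᵗ φ t u = term (λ ρ → if does (holds? φ ρ) then val t ρ else val u ρ)
    (branch (program φ) (code t) (code u)) λ ρ →
    subst (A ⊢ _ ∶ env ρ ↦_) (flip (does (holds? φ ρ)))
      (runs-branch (proj₂ (decides φ ρ)) (runs t ρ) (runs u ρ))
    where
    flip : ∀ b {x y : ℕ} → ifZero (bit b) y x ≡ (if b then x else y)
    flip true  = refl
    flip false = refl

  ifᵗ-cases : ∀ {n} (φ : Formula n) t u ρ →
    (holds φ ρ × val (ifᵗ φ t u) ρ ≡ val t ρ) ⊎ ((¬ holds φ ρ) × val (ifᵗ φ t u) ρ ≡ val u ρ)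
  ifᵗ-cases φ t u ρ with holds? φ ρ
  ... | yes p = inj₁ (p , refl)
  ... | no ¬p = inj₂ (¬p , refl)

-- Facts about programs and the rules deriving them

program-fact : ℕ → ℕ
program-fact e = ⟨ 0 , e ⟩

-- The numbers 0 and 1 tell the two kinds of facts apart. A halting fact is informative only if e is
-- a Gödel number, which is what a fact of the first kind asserts.
halting-fact : ℕ → ℕ → ℕ → ℕ
halting-fact e x y = ⟨ 1 , ⟨ e , ⟨ x , y ⟩ ⟩ ⟩

-- Binds weaker than all connectives, so that tables of sets and tables of formulas can be written
-- alike.
infixr 0 _▸_
pattern _▸_ P Ps = P ∷ Ps

-- O x y is the rule for the oracle, X the set of facts already derived; the
-- bound b keeps the rules decidable.
module Rules (O : ℕ → ℕ → Set) (b : ℕ) (X : ℕ → Set) where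

  ProgramRule : ℕ → ℕ → Set
  ProgramRule t a = select
    ( a ≡ 0 ▸ a ≡ 0 ▸ a ≡ 0 ▸ a ≡ 0 ▸ a ≡ 0 ▸ both ▸ both ▸ both
    ▸ X (program-fact a) ▸ []) t
    where
    both : Set
    both = X (program-fact (π₁ a)) × X (program-fact (π₂ a))

  HaltingRule : ℕ → ℕ → ℕ → ℕ → ℕ → Set
  HaltingRule e t a x y = select
    ( y ≡ 0
    ▸ y ≡ suc x
    ▸ y ≡ π₁ x
    ▸ y ≡ π₂ x
    ▸ O x y
    ▸ X (halting-fact (π₁ a) x (π₁ y)) × X (halting-fact (π₂ a) x (π₂ y))
    ▸ (∃ λ z → z < b × X (halting-fact (π₂ a) x z) × X (halting-fact (π₁ a) z y))
    -- The value at k + 1 rests on a fact about the same program, which is why the rule receives `e`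
    -- besides its components `t` and `a`.
    ▸ (π₂ x ≡ 0 × X (halting-fact (π₁ a) (π₁ x) y)) ⊎
      (∃ λ k → k < b × ∃ λ z → z < b × π₂ x ≡ suc k ×
        X (halting-fact e ⟨ π₁ x , k ⟩ z) ×
        X (halting-fact (π₂ a) ⟨ π₁ x , ⟨ k , z ⟩ ⟩ y))
    ▸ X (halting-fact a ⟨ x , y ⟩ 0) ×
      (∀ i → i < y → ∃ λ k → k < b × X (halting-fact a ⟨ x , i ⟩ (suc k)))
    ▸ []) t

  Rule : ℕ → Set
  Rule h = select
    ( ProgramRule (π₁ (π₂ h)) (π₂ (π₂ h))
    ▸ HaltingRule (π₁ (π₂ h)) (π₁ (π₁ (π₂ h))) (π₂ (π₁ (π₂ h)))
                  (π₁ (π₂ (π₂ h))) (π₂ (π₂ (π₂ h)))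
    ▸ []) (π₁ h)

open Rules

select-program-fact : ∀ (P : ℕ → Set) {Q} e →
  select (P (π₂ (program-fact e)) ∷ Q ∷ []) (π₁ (program-fact e)) ≡ P e
select-program-fact P e rewrite unpair-⟨⟩ 0 e = refl

select-halting-fact : ∀ {P} (Q : ℕ → ℕ → ℕ → Set) e x y → (let h = halting-fact e x y) →
  select (P ∷ Q (π₁ (π₂ h)) (π₁ (π₂ (π₂ h))) (π₂ (π₂ (π₂ h))) ∷ []) (π₁ h) ≡ Q e x y
select-halting-fact Q e x y
  rewrite unpair-⟨⟩ 1 ⟨ e , ⟨ x , y ⟩ ⟩ | unpair-⟨⟩ e ⟨ x , y ⟩ | unpair-⟨⟩ x y = refl

-- Soundness of the rules

module Soundness (B : Pred ℕ 0ℓ) where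

  Fact : ℕ → Set
  Fact h = select
    ( (∃ λ c → ⌜ c ⌝ ≡ π₂ h)
    ∷ (∀ c → π₁ (π₂ h) ≡ ⌜ c ⌝ → ⟦ c ⟧ B (π₁ (π₂ (π₂ h))) (π₂ (π₂ (π₂ h))))
    ∷ []) (π₁ h)

  Fact-program : ∀ e → Fact (program-fact e) → ∃ λ c → ⌜ c ⌝ ≡ e
  Fact-program e = subst id (select-program-fact (λ e → ∃ λ c → ⌜ c ⌝ ≡ e) e)

  Fact-halting : ∀ c {e x y} → e ≡ ⌜ c ⌝ → Fact (halting-fact e x y) → ⟦ c ⟧ B x y
  Fact-halting c {e} {x} {y} eq p =
    subst id (select-halting-fact (λ e x y → ∀ c → e ≡ ⌜ c ⌝ → ⟦ c ⟧ B x y) e x y) p c eq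

  module _ (O : ℕ → ℕ → ℕ → Set) (b : ℕ) (X : ℕ → Set)
           (O-sound : ∀ x y → (∀ t → O t x y) → ⟦ oracle ⟧ B x y)
           (X-sound : ∀ h → X h → Fact h) where

    X-program : ∀ e → X (program-fact e) → ∃ λ c → ⌜ c ⌝ ≡ e
    X-program e = Fact-program e ∘ X-sound _

    X-halting : ∀ c {e x y} → e ≡ ⌜ c ⌝ → X (halting-fact e x y) → ⟦ c ⟧ B x y
    X-halting c eq = Fact-halting c eq ∘ X-sound _

    ProgramRule-sound : ∀ t a → ProgramRule (O 0) b X t a → ∃ λ c → ⌜ c ⌝ ≡ ⟨ t , a ⟩
    ProgramRule-sound 0 a refl = zero , refl
    ProgramRule-sound 1 a refl = succ , refl
    ProgramRule-sound 2 a refl = left , refl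
    ProgramRule-sound 3 a refl = right , refl
    ProgramRule-sound 4 a refl = oracle , refl
    ProgramRule-sound 5 a (p , q) =
      let c , c≡ = X-program (π₁ a) p ; d , d≡ = X-program (π₂ a) q
      in  pair c d , cong ⟨ 5 ,_⟩ (trans (cong₂ ⟨_,_⟩ c≡ d≡) (⟨π₁,π₂⟩ a))
    ProgramRule-sound 6 a (p , q) =
      let c , c≡ = X-program (π₁ a) p ; d , d≡ = X-program (π₂ a) q
      in  comp c d , cong ⟨ 6 ,_⟩ (trans (cong₂ ⟨_,_⟩ c≡ d≡) (⟨π₁,π₂⟩ a))
    ProgramRule-sound 7 a (p , q) =
      let c , c≡ = X-program (π₁ a) p ; d , d≡ = X-program (π₂ a) q
      in  prec c d , cong ⟨ 7 ,_⟩ (trans (cong₂ ⟨_,_⟩ c≡ d≡) (⟨π₁,π₂⟩ a))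
    ProgramRule-sound 8 a p =
      let c , c≡ = X-program a p in μ c , cong ⟨ 8 ,_⟩ c≡
    ProgramRule-sound (suc (suc (suc (suc (suc (suc (suc (suc (suc t))))))))) a ()

    -- Only the oracle rule varies with the stage t; every other case reads the rule at stage 0.
    HaltingRule-sound : ∀ c x y → (∀ t → HaltingRule (O t) b X ⌜ c ⌝ (tag c) (arg c) x y) →
                        ⟦ c ⟧ B x y
    HaltingRule-sound zero       x y r = r 0
    HaltingRule-sound succ       x y r = r 0
    HaltingRule-sound left       x y r = r 0
    HaltingRule-sound right      x y r = r 0
    HaltingRule-sound oracle     x y r = O-sound x y r
    HaltingRule-sound (pair c d) x y r =
      let p , q = r 0
      in  _ , _ , X-halting c (π₁-⟨⟩ ⌜ c ⌝ ⌜ d ⌝) p , X-halting d (π₂-⟨⟩ ⌜ c ⌝ ⌜ d ⌝) q , sym (⟨π₁,π₂⟩ y)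
    HaltingRule-sound (comp c d) x y r =
      let z , _ , p , q = r 0
      in  z , X-halting d (π₂-⟨⟩ ⌜ c ⌝ ⌜ d ⌝) p , X-halting c (π₁-⟨⟩ ⌜ c ⌝ ⌜ d ⌝) q
    HaltingRule-sound (prec c d) x y r with r 0
    ... | inj₁ (eq , p) =
      subst (λ k → PrimRec (⟦ c ⟧ B) (⟦ d ⟧ B) (π₁ x) k y) (sym eq) (X-halting c (π₁-⟨⟩ ⌜ c ⌝ ⌜ d ⌝) p)
    ... | inj₂ (k , _ , z , _ , eq , p , q) =
      subst (λ k → PrimRec (⟦ c ⟧ B) (⟦ d ⟧ B) (π₁ x) k y) (sym eq)
        (z ,
         subst (λ (a , k) → PrimRec (⟦ c ⟧ B) (⟦ d ⟧ B) a k z) (unpair-⟨⟩ (π₁ x) k)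
           (X-halting (prec c d) {x = ⟨ π₁ x , k ⟩} refl p) ,
         X-halting d (π₂-⟨⟩ ⌜ c ⌝ ⌜ d ⌝) q)
    HaltingRule-sound (μ c)      x y r =
      let p , q = r 0
      in  X-halting c refl p , λ i i<y → let k , _ , s = q i i<y in k , X-halting c refl s

    Rule-sound : ∀ h → (∀ t → Rule (O t) b X h) → Fact h
    Rule-sound h = decompose (π₁ h)
      (λ r → let c , eq = ProgramRule-sound (π₁ (π₂ h)) (π₂ (π₂ h)) (r 0) in c , trans eq (⟨π₁,π₂⟩ (π₂ h)))
      (λ r c eq → HaltingRule-sound c _ _ λ t →
        subst id (at-code c eq (λ e t′ a → HaltingRule (O t) b X e t′ a _ _)) (r t))
      where
      decompose : ∀ {P Q : ℕ → Set} {P′ Q′} n → ((∀ t → P t) → P′) → ((∀ t → Q t) → Q′) →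
                  (∀ t → select (P t ∷ Q t ∷ []) n) → select (P′ ∷ Q′ ∷ []) n
      decompose 0             f g r = f r
      decompose 1             f g r = g r
      decompose (suc (suc n)) f g r = r 0

      at-code : ∀ {e} c → e ≡ ⌜ c ⌝ → (P : ℕ → ℕ → ℕ → Set) →
                P e (π₁ e) (π₂ e) ≡ P ⌜ c ⌝ (tag c) (arg c)
      at-code c refl P = cong (λ (t , a) → P ⌜ c ⌝ t a)
        (trans (cong unpair (⌜⌝-tag-arg c)) (unpair-⟨⟩ (tag c) (arg c)))

-- Completeness of the rules

module Completeness (B : Pred ℕ 0ℓ) (O : ℕ → ℕ → ℕ → ℕ → Set) where

  -- The rules are required for all larger bounds and sets of facts, which
  -- makes concatenation of lists harmless without any monotonicity of the rules.
  data Valid (b : ℕ) : List ℕ → Set₁ where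
    []  : Valid b []
    _∷_ : ∀ {h l} →
          (∀ {b′} {X : ℕ → Set} → b ≤ b′ → (∀ {h′} → h′ ∈ l → X h′) → ∀ t → Rule (O b′ t) b′ X h) →
          Valid b l → Valid b (h ∷ l)

  -- A condition on the bound and the set of facts that is enforced by a large enough bound together
  -- with finitely many validly derived facts. Such conditions are closed under conjunction and
  -- bounded quantification.
  Derivable : (ℕ → (ℕ → Set) → Set) → Set₁
  Derivable Q = ∃ λ b → ∃ λ l → Valid b l ×
    (∀ {b′} {X : ℕ → Set} → b ≤ b′ → (∀ {h} → h ∈ l → X h) → Q b′ X)

  Valid-++ : ∀ {b b′ l l′} → Valid b l → Valid b′ l′ → Valid (b + b′) (l ++ l′)
  Valid-++ {b} {b′} [] v = weaken v
    where
    weaken : ∀ {l} → Valid b′ l → Valid (b + b′) l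
    weaken []      = []
    weaken (r ∷ v) = (λ b≤ → r (≤-trans (m≤n+m b′ b) b≤)) ∷ weaken v
  Valid-++ {b} {b′} (r ∷ u) v =
    (λ b≤ X⊇ → r (≤-trans (m≤m+n b b′) b≤) (X⊇ ∘ ∈-++⁺ˡ)) ∷ Valid-++ u v

  both : ∀ {Q R} → Derivable Q → Derivable R → Derivable (λ b X → Q b X × R b X)
  both (b , l , u , q) (b′ , l′ , v , r) = b + b′ , l ++ l′ , Valid-++ u v , λ b≤ X⊇ →
    q (≤-trans (m≤m+n b b′) b≤) (X⊇ ∘ ∈-++⁺ˡ) , r (≤-trans (m≤n+m b′ b) b≤) (X⊇ ∘ ∈-++⁺ʳ l)

  weaken : ∀ {Q R : ℕ → (ℕ → Set) → Set} → (∀ {b X} → Q b X → R b X) → Derivable Q → Derivable R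
  weaken f (b , l , v , q) = b , l , v , λ b≤ X⊇ → f (q b≤ X⊇)

  bounded : ∀ z → Derivable (λ b _ → z < b)
  bounded z = suc z , [] , [] , λ z<b _ → z<b

  always : ∀ {P : Set} → P → Derivable (λ _ _ → P)
  always p = 0 , [] , [] , λ _ _ → p

  all : ∀ {Q : ℕ → ℕ → (ℕ → Set) → Set} n → (∀ i → i < n → Derivable (Q i)) →
        Derivable (λ b X → ∀ i → i < n → Q i b X)
  all zero    f = 0 , [] , [] , λ _ _ _ ()
  all {Q} (suc n) f = weaken (λ (q , r) → extend q r)
    (both (all n (λ i i<n → f i (m<n⇒m<1+n i<n))) (f n ≤-refl))
    where
    extend : ∀ {b X} → (∀ i → i < n → Q i b X) → Q n b X → ∀ i → i < suc n → Q i b X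
    extend q r i i<1+n with m<1+n⇒m<n∨m≡n i<1+n
    ... | inj₁ i<n  = q i i<n
    ... | inj₂ refl = r

  -- The new fact goes in front of the list, so that every entry is justified by the entries after
  -- it.
  by-rule : ∀ h → Derivable (λ b X → ∀ t → Rule (O b t) b X h) → Derivable (λ _ X → X h)
  by-rule h (b , l , v , r) = b , h ∷ l , r ∷ v , λ _ X⊇ → X⊇ (here refl)

  by-program-rule : ∀ e c → e ≡ ⌜ c ⌝ →
    Derivable (λ b X → ∀ t → ProgramRule (O b t) b X (tag c) (arg c)) →
    Derivable (λ _ X → X (program-fact e))
  by-program-rule e c refl = by-rule (program-fact e) ∘ weaken λ {b} {X} r t → subst id
    (sym (trans (select-program-fact (λ e → ProgramRule (O b t) b X (π₁ e) (π₂ e)) e)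
                (cong (λ (n , a) → ProgramRule (O b t) b X n a)
                      (trans (cong unpair (⌜⌝-tag-arg c)) (unpair-⟨⟩ (tag c) (arg c))))))
    (r t)

  by-halting-rule : ∀ e c x y → e ≡ ⌜ c ⌝ →
    Derivable (λ b X → ∀ t → HaltingRule (O b t) b X ⌜ c ⌝ (tag c) (arg c) x y) →
    Derivable (λ _ X → X (halting-fact e x y))
  by-halting-rule e c x y refl = by-rule (halting-fact e x y) ∘ weaken λ {b} {X} r t → subst id
    (sym (trans (select-halting-fact (λ e → HaltingRule (O b t) b X e (π₁ e) (π₂ e)) e x y)
                (cong (λ (n , a) → HaltingRule (O b t) b X e n a x y)
                      (trans (cong unpair (⌜⌝-tag-arg c)) (unpair-⟨⟩ (tag c) (arg c))))))
    (r t)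

  -- The number e is kept apart from `⌜ c ⌝` because the rules name subprograms by projections of a
  -- code, which equal their Gödel numbers only up to a proof.
  program-derivable : ∀ c e → e ≡ ⌜ c ⌝ → Derivable (λ _ X → X (program-fact e))
  program-derivable c@zero       e eq = by-program-rule e c eq (always λ _ → refl)
  program-derivable c@succ       e eq = by-program-rule e c eq (always λ _ → refl)
  program-derivable c@left       e eq = by-program-rule e c eq (always λ _ → refl)
  program-derivable c@right      e eq = by-program-rule e c eq (always λ _ → refl)
  program-derivable c@oracle     e eq = by-program-rule e c eq (always λ _ → refl)
  program-derivable p@(pair c d) e eq = by-program-rule e p eq (weaken (λ r _ → r)
    (both (program-derivable c _ (π₁-⟨⟩ ⌜ c ⌝ ⌜ d ⌝)) (program-derivable d _ (π₂-⟨⟩ ⌜ c ⌝ ⌜ d ⌝))))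
  program-derivable p@(comp c d) e eq = by-program-rule e p eq (weaken (λ r _ → r)
    (both (program-derivable c _ (π₁-⟨⟩ ⌜ c ⌝ ⌜ d ⌝)) (program-derivable d _ (π₂-⟨⟩ ⌜ c ⌝ ⌜ d ⌝))))
  program-derivable p@(prec c d) e eq = by-program-rule e p eq (weaken (λ r _ → r)
    (both (program-derivable c _ (π₁-⟨⟩ ⌜ c ⌝ ⌜ d ⌝)) (program-derivable d _ (π₂-⟨⟩ ⌜ c ⌝ ⌜ d ⌝))))
  program-derivable p@(μ c)      e eq = by-program-rule e p eq (weaken (λ r _ → r)
    (program-derivable c _ refl))

  module _ (O-complete : ∀ {x y} → ⟦ oracle ⟧ B x y → ∃ λ b → ∀ {b′} → b ≤ b′ → ∀ t → O b′ t x y) where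

    halting-derivable : ∀ c e x y → e ≡ ⌜ c ⌝ → ⟦ c ⟧ B x y →
                        Derivable (λ _ X → X (halting-fact e x y))
    -- Induction on k. The input x is specified by its projections, so that the induction hypothesis
    -- applies to `⟨ a , k ⟩`.
    prec-derivable : ∀ c d e a k y → e ≡ ⌜ prec c d ⌝ → PrimRec (⟦ c ⟧ B) (⟦ d ⟧ B) a k y →
                     ∀ x → π₁ x ≡ a → π₂ x ≡ k → Derivable (λ _ X → X (halting-fact e x y))

    halting-derivable c@zero       e x y eq p = by-halting-rule e c x y eq (always λ _ → p)
    halting-derivable c@succ       e x y eq p = by-halting-rule e c x y eq (always λ _ → p)
    halting-derivable c@left       e x y eq p = by-halting-rule e c x y eq (always λ _ → p)
    halting-derivable c@right      e x y eq p = by-halting-rule e c x y eq (always λ _ → p)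
    halting-derivable c@oracle     e x y eq p = by-halting-rule e c x y eq
      (let b , o = O-complete p in b , [] , [] , λ b≤ _ → o b≤)
    halting-derivable q@(pair c d) e x y eq (u , v , p , p′ , y≡) =
      by-halting-rule e q x y eq (weaken (λ r _ → r) (both
        (halting-derivable c (π₁ (arg q)) x (π₁ y) (π₁-⟨⟩ ⌜ c ⌝ ⌜ d ⌝)
          (subst (⟦ c ⟧ B x) (sym (trans (cong π₁ y≡) (π₁-⟨⟩ u v))) p))
        (halting-derivable d (π₂ (arg q)) x (π₂ y) (π₂-⟨⟩ ⌜ c ⌝ ⌜ d ⌝)
          (subst (⟦ d ⟧ B x) (sym (trans (cong π₂ y≡) (π₂-⟨⟩ u v))) p′))))
    halting-derivable q@(comp c d) e x y eq (z , p , p′) =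
      by-halting-rule e q x y eq (weaken (λ r _ → z , r) (both (bounded z) (both
        (halting-derivable d (π₂ (arg q)) x z (π₂-⟨⟩ ⌜ c ⌝ ⌜ d ⌝) p)
        (halting-derivable c (π₁ (arg q)) z y (π₁-⟨⟩ ⌜ c ⌝ ⌜ d ⌝) p′))))
    halting-derivable (prec c d)   e x y eq p =
      prec-derivable c d e (π₁ x) (π₂ x) y eq p x refl refl
    halting-derivable q@(μ c)      e x y eq (p , below) =
      by-halting-rule e q x y eq (weaken (λ r _ → r) (both
        (halting-derivable c _ ⟨ x , y ⟩ 0 refl p)
        (all y λ i i<y → let k , r = below i i<y in weaken (λ r → k , r) (both (bounded k)
          (halting-derivable c _ ⟨ x , i ⟩ (suc k) refl r)))))

    prec-derivable c d e a zero    y eq p x refl eq′ =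
      by-halting-rule e (prec c d) x y eq (weaken (λ r _ → inj₁ (eq′ , r))
        (halting-derivable c _ a y (π₁-⟨⟩ ⌜ c ⌝ ⌜ d ⌝) p))
    prec-derivable c d e a (suc k) y eq (z , p , p′) x refl eq′ =
      by-halting-rule e (prec c d) x y eq
        (weaken (λ (k< , z< , r , r′) _ → inj₂ (k , k< , z , z< , eq′ , r , r′))
          (both (bounded k) (both (bounded z) (both
            (prec-derivable c d _ a k z refl p ⟨ a , k ⟩ (π₁-⟨⟩ a k) (π₂-⟨⟩ a k))
            (halting-derivable d _ ⟨ a , ⟨ k , z ⟩ ⟩ y (π₂-⟨⟩ ⌜ c ⌝ ⌜ d ⌝) p′)))))

-- Certificates as coded lists of facts

drop : ℕ → ℕ → ℕ
drop L zero    = L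
drop L (suc j) = π₂ (drop L j)

-- Since 0 is `⟨ 0 , 0 ⟩`, every number has entries at all positions; hence a certificate states the
-- length of its list separately.
entry : ℕ → ℕ → ℕ
entry L j = π₁ (drop L j)

encode : List ℕ → ℕ
encode []      = 0
encode (h ∷ l) = ⟨ h , encode l ⟩

entry-∷ : ∀ h L j → entry ⟨ h , L ⟩ (suc j) ≡ entry L j
entry-∷ h L j = cong π₁ (shift j)
  where
  shift : ∀ j → drop ⟨ h , L ⟩ (suc j) ≡ drop L j
  shift zero    = π₂-⟨⟩ h L
  shift (suc j) = cong π₂ (shift j)

Later : ℕ → ℕ → ℕ → ℕ → Set
Later n L i h = ∃ λ j → j < n × i < j × entry L j ≡ h

-- w consists of the length n, the list L and the bound b of the rules. Justification by strictly
-- later entries excludes circular derivations.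
Certifies : (ℕ → ℕ → ℕ → ℕ → Set) → ℕ → ℕ → ℕ → Set
Certifies O w t h =
  (∀ i → i < n → Rule (O b t) b (Later n L i) (entry L i)) × (∃ λ j → j < n × entry L j ≡ h)
  where
  n = π₁ w
  L = π₁ (π₂ w)
  b = π₂ (π₂ w)

decode-triple : ∀ {x y z} (P : ℕ → ℕ → ℕ → Set) → P x y z →
                (let w = ⟨ x , ⟨ y , z ⟩ ⟩) → P (π₁ w) (π₁ (π₂ w)) (π₂ (π₂ w))
decode-triple {x} {y} {z} P p rewrite unpair-⟨⟩ x ⟨ y , z ⟩ | unpair-⟨⟩ y z = p

module _ (B : Pred ℕ 0ℓ) (O : ℕ → ℕ → ℕ → ℕ → Set) where
  open Soundness B
  open Completeness B O

  Certifies-sound : (∀ {b x y} → (∀ t → O b t x y) → ⟦ oracle ⟧ B x y) →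
                    ∀ {w h} → (∀ t → Certifies O w t h) → Fact h
  Certifies-sound O-sound {w} {h} certified =
    let j , j<n , eq = proj₂ (certified 0) in subst Fact eq (facts n j (m≤n+m n j) j<n)
    where
    n = π₁ w
    L = π₁ (π₂ w)
    b = π₂ (π₂ w)

    -- Induction from the end of the list: k bounds the number of entries from position i on.
    facts : ∀ k i → n ≤ i + k → i < n → Fact (entry L i)
    facts zero    i n≤ i<n = ⊥-elim (<⇒≱ i<n (subst (n ≤_) (+-identityʳ i) n≤))
    facts (suc k) i n≤ i<n = Rule-sound (O b) b (Later n L i) (λ _ _ → O-sound)
      (λ h (j , j<n , i<j , eq) → subst Fact eq
        (facts k j (≤-trans n≤ (≤-trans (≤-reflexive (+-suc i k)) (+-monoˡ-≤ k i<j))) j<n))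
      (entry L i) (λ t → proj₁ (certified t) i i<n)

  entry-∈ : ∀ {h l} → h ∈ l → ∃ λ j → j < length l × entry (encode l) j ≡ h
  entry-∈ {l = h ∷ l} (here refl) = 0 , z<s , π₁-⟨⟩ h (encode l)
  entry-∈ {l = h ∷ l} (there h∈l) =
    let j , j< , eq = entry-∈ h∈l in suc j , s<s j< , trans (entry-∷ h (encode l) j) eq

  entry-Rule : ∀ {b l} → Valid b l → ∀ i → i < length l → ∀ {X : ℕ → Set} →
    (∀ {h} → Later (length l) (encode l) i h → X h) → ∀ t → Rule (O b t) b X (entry (encode l) i)
  entry-Rule {b} {h ∷ l} (r ∷ v) zero i< {X} X⊇ t =
    subst (Rule (O b t) b X) (sym (π₁-⟨⟩ h (encode l)))
      (r ≤-refl (λ h′∈l → let j , j< , eq = entry-∈ h′∈l in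
        X⊇ (suc j , s<s j< , z<s , trans (entry-∷ h (encode l) j) eq)) t)
  entry-Rule {b} {h ∷ l} (r ∷ v) (suc i) (s≤s i<) {X} X⊇ t =
    subst (Rule (O b t) b X) (sym (entry-∷ h (encode l) i))
      (entry-Rule v i i< (λ (j , j< , i<j , eq) →
        X⊇ (suc j , s<s j< , s<s i<j , trans (entry-∷ h (encode l) j) eq)) t)

  Certifies-complete : ∀ {h} → Derivable (λ _ X → X h) → ∃ λ w → ∀ t → Certifies O w t h
  Certifies-complete {h} (b , l , v , q) = ⟨ length l , ⟨ encode l , b ⟩ ⟩ , λ t →
    decode-triple (λ n L b → (∀ i → i < n → Rule (O b t) b (Later n L i) (entry L i)) ×
                       (∃ λ j → j < n × entry L j ≡ h))
      ((λ i i< → entry-Rule v i i< id t) , entry-∈ (q ≤-refl id))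

-- Checking certificates recursively in A

module Certificates {A : Pred ℕ 0ℓ} (A? : Decidable A) where
  open Recursive A?

  entryᵗ : ∀ {k} → Term k → Term k → Term k
  entryᵗ L j = π₁ᵗ (as (rec L (π₂ᵗ (var 1F)) j) (λ ρ → drop (val L ρ) (val j ρ))
                       (λ ρ → eq ρ (val j ρ)))
    where
    eq : ∀ ρ k → iterate (val L) (val (π₂ᵗ (var 1F))) ρ k ≡ drop (val L ρ) k
    eq ρ zero    = refl
    eq ρ (suc k) = cong π₂ (eq ρ k)

  program-factᵗ : ∀ {k} → Term k → Term k
  program-factᵗ e = ⟨ # 0 , e ⟩ᵗ

  halting-factᵗ : ∀ {k} → Term k → Term k → Term k → Term k
  halting-factᵗ e x y = ⟨ # 1 , ⟨ e , ⟨ x , y ⟩ᵗ ⟩ᵗ ⟩ᵗ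

  laterᶠ : ∀ {k} → Term k → Term k → Term k → Term k → Formula k
  laterᶠ n L i h = any< n (↑ i <ᶠ var 0F ∧ entryᵗ (↑ L) (var 0F) ≡ᶠ ↑ h)

  module _ (O : Formula 4) where

    program-ruleᶠ : ∀ {k} → (Term k → Formula k) → Term k → Term k → Formula k
    program-ruleᶠ X t a = switch t
      ( a ≡ᶠ # 0 ▸ a ≡ᶠ # 0 ▸ a ≡ᶠ # 0 ▸ a ≡ᶠ # 0 ▸ a ≡ᶠ # 0 ▸ both ▸ both ▸ both
      ▸ X (program-factᵗ a) ▸ [])
      where
      both : Formula _
      both = X (program-factᵗ (π₁ᵗ a)) ∧ X (program-factᵗ (π₂ᵗ a))

    -- X takes a weakening as its first argument, so that membership in the set of facts can be
    -- expressed under no, one or two bounded quantifiers.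
    halting-ruleᶠ : ∀ {k} → Term k → Term k → (∀ {k′} → (Term k → Term k′) → Term k′ → Formula k′) →
                    Term k → Term k → Term k → Term k → Term k → Formula k
    halting-ruleᶠ b s X e t a x y = switch t
      ( y ≡ᶠ # 0
      ▸ y ≡ᶠ sucᵗ x
      ▸ y ≡ᶠ π₁ᵗ x
      ▸ y ≡ᶠ π₂ᵗ x
      ▸ O [ x ∷ y ∷ b ∷ s ∷ [] ]
      ▸ X₀ (halting-factᵗ (π₁ᵗ a) x (π₁ᵗ y)) ∧ X₀ (halting-factᵗ (π₂ᵗ a) x (π₂ᵗ y))
      ▸ any< b
          ( X₁ (halting-factᵗ (↑ π₂ᵗ a) (↑ x) (var 0F))
          ∧ X₁ (halting-factᵗ (↑ π₁ᵗ a) (var 0F) (↑ y)))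
      ▸ (π₂ᵗ x ≡ᶠ # 0 ∧ X₀ (halting-factᵗ (π₁ᵗ a) (π₁ᵗ x) y)) ∨
        any< b (any< (↑ b)
          ( ↑ ↑ π₂ᵗ x ≡ᶠ sucᵗ (var 1F)
          ∧ X₂ (halting-factᵗ (↑ ↑ e) ⟨ ↑ ↑ π₁ᵗ x , var 1F ⟩ᵗ (var 0F))
          ∧ X₂ (halting-factᵗ (↑ ↑ π₂ᵗ a) ⟨ ↑ ↑ π₁ᵗ x , ⟨ var 1F , var 0F ⟩ᵗ ⟩ᵗ (↑ ↑ y))))
      ▸ X₀ (halting-factᵗ a ⟨ x , y ⟩ᵗ (# 0)) ∧
        all< y (any< (↑ b) (X₂ (halting-factᵗ (↑ ↑ a) ⟨ ↑ ↑ x , var 1F ⟩ᵗ (sucᵗ (var 0F)))))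
      ▸ [])
      where
      X₀ = X id
      X₁ = X ↑_
      X₂ = X (λ t → ↑ ↑ t)

    ruleᶠ : ∀ {k} → Term k → Term k → (∀ {k′} → (Term k → Term k′) → Term k′ → Formula k′) →
            Term k → Formula k
    ruleᶠ b s X h = switch (π₁ᵗ h)
      ( program-ruleᶠ (X id) (π₁ᵗ (π₂ᵗ h)) (π₂ᵗ (π₂ᵗ h))
      ▸ halting-ruleᶠ b s X (π₁ᵗ (π₂ᵗ h)) (π₁ᵗ (π₁ᵗ (π₂ᵗ h))) (π₂ᵗ (π₁ᵗ (π₂ᵗ h)))
                            (π₁ᵗ (π₂ᵗ (π₂ᵗ h))) (π₂ᵗ (π₂ᵗ (π₂ᵗ h)))
      ▸ [])

    -- The tables of formulas unfold to the tables of `Rules`, so both directions of `asᶠ` are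
    -- identities.
    certifiesᶠ : ∀ {k} → Term k → Term k → Term k → Formula k
    certifiesᶠ w t h = asᶠ
      (all< n (ruleᶠ (↑ b) (↑ t)
        (λ lift → laterᶠ (lift (↑ n)) (lift (↑ L)) (lift (var 0F)))
        (entryᵗ (↑ L) (var 0F)))
      ∧ any< n (entryᵗ (↑ L) (var 0F) ≡ᶠ ↑ h))
      (λ ρ → Certifies (λ b t x y → holds O (x ∷ y ∷ b ∷ t ∷ [])) (val w ρ) (val t ρ) (val h ρ))
      (λ _ → id) (λ _ → id)
      where
      n = π₁ᵗ w
      L = π₁ᵗ (π₂ᵗ w)
      b = π₂ᵗ (π₂ᵗ w)

-- Codes of integers and words, and maxima

codeDifference : ℕ → ℕ → ℕ
codeDifference m n = 2 * (m ∸ n) + (2 * (n ∸ m) ∸ 1)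

-- Truncated subtraction makes one summand vanish. What remains is 2(m - n) if n ≤ m, and otherwise
-- 2(n - m) - 1, the code of a negative integer.
codeDifference-codeℤ : ∀ m n → codeDifference m n ≡ codeℤ (+ m - + n)
codeDifference-codeℤ m n = trans (by-sign (≤-<-connex n m)) (cong codeℤ (sym (ℤ.m-n≡m⊖n m n)))
  where
  by-sign : n ≤ m ⊎ m < n → codeDifference m n ≡ codeℤ (m ⊖ n)
  by-sign (inj₁ n≤m) rewrite m≤n⇒m∸n≡0 n≤m | ℤ.⊖-≥ n≤m = +-identityʳ _
  by-sign (inj₂ m<n) with n ∸ m in eq
  ... | zero  = ⊥-elim (<⇒≱ m<n (m∸n≡0⇒m≤n eq))
  ... | suc k rewrite m≤n⇒m∸n≡0 (<⇒≤ m<n) | ℤ.⊖-< m<n | eq = +-suc k (k + 0)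

codeℤ-injective : ∀ {i j} → codeℤ i ≡ codeℤ j → i ≡ j
codeℤ-injective {+ m}      {+ n}      eq = cong +_ (*-cancelˡ-≡ m n 2 eq)
codeℤ-injective {+ m}      { -[1+ n ]} eq = ⊥-elim (even≢odd m n eq)
codeℤ-injective { -[1+ m ]} {+ n}      eq = ⊥-elim (even≢odd n m (sym eq))
codeℤ-injective { -[1+ m ]} { -[1+ n ]} eq = cong -[1+_] (*-cancelˡ-≡ m n 2 (suc-injective eq))

codeWord-surjective : ∀ x → ∃ λ p → codeWord p ≡ x
codeWord-surjective zero    = [] , refl
codeWord-surjective (suc x) = let p , eq = codeWord-surjective x in
  increment p , trans (codeWord-increment p) (cong suc eq)
  where
  increment : Word → Word
  increment []          = false ∷ []
  increment (false ∷ p) = true ∷ p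
  increment (true ∷ p)  = false ∷ increment p

  codeWord-increment : ∀ p → codeWord (increment p) ≡ suc (codeWord p)
  codeWord-increment []          = refl
  codeWord-increment (false ∷ p) = refl
  codeWord-increment (true ∷ p)  = cong suc
    (trans (cong (2 *_) (codeWord-increment p)) (*-suc 2 (codeWord p)))

IsMax-cong : ∀ {h h′ m} → (∀ t → h t ≡ h′ t) → IsMax h m → IsMax h′ m
IsMax-cong eq ((t , p) , q) = (t , trans (sym (eq t)) p) , λ t → subst (_≤ _) (eq t) (q t)

IsMax-unique : ∀ {h m n} → IsMax h m → IsMax h n → m ≡ n
IsMax-unique ((t , refl) , m≥) ((u , refl) , n≥) = ≤-antisym (n≥ t) (m≥ u)

bound-witnesses : ∀ {P : ℕ → ℕ → Set} n → (∀ i → i < n → ∃ (P i)) →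
                  ∃ λ b → ∀ i → i < n → ∃ λ t → t < b × P i t
bound-witnesses zero    f = 0 , λ _ ()
bound-witnesses {P} (suc n) f = b + suc (proj₁ (f n ≤-refl)) , below
  where
  b,g : ∃ λ b → ∀ i → i < n → ∃ λ t → t < b × P i t
  b,g = bound-witnesses n (λ i i<n → f i (m<n⇒m<1+n i<n))
  b = proj₁ b,g

  below : ∀ i → i < suc n → ∃ λ t → t < b + suc (proj₁ (f n ≤-refl)) × P i t
  below i i<1+n with m<1+n⇒m<n∨m≡n i<1+n
  ... | inj₁ i<n  = let t , t<b , p = proj₂ b,g i i<n in t , ≤-trans t<b (m≤m+n b _) , p
  ... | inj₂ refl = let t , p = f n ≤-refl in t , m≤n+m (suc t) b , p

-- Terms as programs, unbounded search and queries to the jump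

module RecursiveIn {A : Pred ℕ 0ℓ} (A? : Decidable A) where
  open Recursive A?

  binary : Program
  binary = pair left (pair right zero)

  runs-binary : ∀ x y → A ⊢ binary ∶ ⟨ x , y ⟩ ↦ env (x ∷ y ∷ [])
  runs-binary x y = runs-left x y ,ʳ runs-right x y ,ʳ run refl

  val-recursive : ∀ F → TotalRecursiveIn A (λ (p , t) → val F (codeWord p ∷ t ∷ []))
  val-recursive F = comp (code F) binary , λ p t y → mk⇔
    (deterministic (comp (code F) binary) {⟨ codeWord p , t ⟩} (halts (evaluates p t)))
    (λ eq → subst (⟦ comp (code F) binary ⟧ A ⟨ codeWord p , t ⟩) eq (halts (evaluates p t)))
    where
    evaluates : ∀ p t → A ⊢ comp (code F) binary ∶ ⟨ codeWord p , t ⟩ ↦ val F (codeWord p ∷ t ∷ [])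
    evaluates p t = runs-binary (codeWord p) t ⨾ runs F (codeWord p ∷ t ∷ [])

  -- A term must be defined on all numbers; as `codeWord` is onto, every number can be read as a
  -- word.
  recursive-val : ∀ f → TotalRecursiveIn A f →
                  Σ (Term 2) λ F → ∀ p t → val F (codeWord p ∷ t ∷ []) ≡ f (p , t)
  recursive-val f (c , correct) =
    term (λ where (x ∷ t ∷ []) → f (word x , t)) (comp c (pair left (comp left right)))
      (λ where
        (x ∷ t ∷ []) →
          (runs-left x ⟨ t , 0 ⟩ ,ʳ (runs-right x ⟨ t , 0 ⟩ ⨾ runs-left t 0)) ⨾ run (evaluates x t)) ,
    -- The word chosen for `codeWord p` has the same code as p, so one run computes f at both.
    λ p t → sym (to (correct p t _) (evaluates (codeWord p) t))
    where
    word : ℕ → Word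
    word x = proj₁ (codeWord-surjective x)

    evaluates : ∀ x t → ⟦ c ⟧ A ⟨ x , t ⟩ (f (word x , t))
    evaluates x t = subst (λ x′ → ⟦ c ⟧ A ⟨ x′ , t ⟩ (f (word x , t)))
      (proj₂ (codeWord-surjective x)) (from (correct (word x) t _) refl)

  codeDifferenceᵗ : ∀ {k} → Term k → Term k → Term k
  codeDifferenceᵗ m n = # 2 *ᵗ (m ∸ᵗ n) +ᵗ (# 2 *ᵗ (n ∸ᵗ m) ∸ᵗ # 1)

  -- `μ` stops at output 0, which stands for false; the search therefore finds the least y that
  -- refutes `φ`.
  search : Formula 2 → Program
  search φ = μ (comp (program φ) binary)

  search-halts : ∀ φ x y → ⟦ search φ ⟧ A x y ⇔
    ((¬ holds φ (x ∷ y ∷ [])) × (∀ i → i < y → holds φ (x ∷ i ∷ [])))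
  search-halts φ x y = mk⇔
    (λ (p , below) → no-of y p , λ i i<y → yes-of i (proj₂ (below i i<y)))
    (λ (p , below) → of-no y p , λ i i<y → 0 , of-yes i (below i i<y))
    where
    c = comp (program φ) binary

    decision : ∀ i → A ⊢ c ∶ ⟨ x , i ⟩ ↦ bit (does (holds? φ (x ∷ i ∷ [])))
    decision i = runs-binary x i ⨾ proj₂ (decides φ (x ∷ i ∷ []))

    no-of : ∀ i → ⟦ c ⟧ A ⟨ x , i ⟩ 0 → ¬ holds φ (x ∷ i ∷ [])
    no-of i p with holds? φ (x ∷ i ∷ []) | decision i
    ... | yes _ | q = ⊥-elim (0≢1+n (deterministic c {⟨ x , i ⟩} p (halts q)))
    ... | no ¬h | _ = ¬h

    yes-of : ∀ i {k} → ⟦ c ⟧ A ⟨ x , i ⟩ (suc k) → holds φ (x ∷ i ∷ [])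
    yes-of i p with holds? φ (x ∷ i ∷ []) | decision i
    ... | yes h | _ = h
    ... | no _  | q = ⊥-elim (0≢1+n (deterministic c {⟨ x , i ⟩} (halts q) p))

    of-no : ∀ i → ¬ holds φ (x ∷ i ∷ []) → ⟦ c ⟧ A ⟨ x , i ⟩ 0
    of-no i ¬h with holds? φ (x ∷ i ∷ []) | decision i
    ... | yes h | _ = ⊥-elim (¬h h)
    ... | no _  | q = halts q

    of-yes : ∀ i → holds φ (x ∷ i ∷ []) → ⟦ c ⟧ A ⟨ x , i ⟩ 1
    of-yes i h with holds? φ (x ∷ i ∷ []) | decision i
    ... | yes _ | q = halts q
    ... | no ¬h | _ = ⊥-elim (¬h h)

  -- An instance of the s-m-n theorem: the Gödel number of a program with a fixed input is computed
  -- from that input. The constant 6 is the tag of `comp`.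
  numeral-codeᵗ : ∀ {k} → Term k → Term k
  numeral-codeᵗ t = as
    (rec (# ⌜ zero ⌝) ⟨ # 6 , ⟨ # ⌜ succ ⌝ , var 1F ⟩ᵗ ⟩ᵗ t) (λ ρ → ⌜ numeral (val t ρ) ⌝)
    (λ ρ → eq ρ (val t ρ))
    where
    eq : ∀ ρ k →
      iterate (λ _ → ⌜ zero ⌝) (val ⟨ # 6 , ⟨ # ⌜ succ ⌝ , var 1F ⟩ᵗ ⟩ᵗ) ρ k ≡ ⌜ numeral k ⌝
    eq ρ zero    = refl
    eq ρ (suc k) = cong (λ n → ⟨ 6 , ⟨ ⌜ succ ⌝ , n ⟩ ⟩) (eq ρ k)

  callᵗ : ∀ {k} → Program → Term k → Term k
  callᵗ c t = as ⟨ # 6 , ⟨ # ⌜ c ⌝ , numeral-codeᵗ t ⟩ᵗ ⟩ᵗ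
    (λ ρ → ⌜ comp c (numeral (val t ρ)) ⌝) (λ _ → refl)

-- `numeral k` ignores its input, so running the composite on its own Gödel number amounts to
-- running c on k.
′-call : ∀ {A : Pred ℕ 0ℓ} c k → (A ′) ⌜ comp c (numeral k) ⌝ ⇔ ∃ (⟦ c ⟧ A k)
′-call {A} c k = mk⇔ forwards λ (y , p) →
  comp c (numeral k) , refl , y , k , halts (runs-numeral k ⌜ comp c (numeral k) ⌝) , p
  where
  forwards : (A ′) ⌜ comp c (numeral k) ⌝ → ∃ (⟦ c ⟧ A k)
  forwards (d , eq , y , p) with refl ← ⌜⌝-injective d (comp c (numeral k)) eq =
    let z , q , r = p
    in  y , subst (λ z → ⟦ c ⟧ A z y) (deterministic (numeral k) q (halts (runs-numeral k ⌜ comp c (numeral k) ⌝))) r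

-- Classical reasoning and maxima computed from the jump

module Classical (em : ExcludedMiddle 0ℓ) where

  least-below : ∀ (P : ℕ → Set) n →
                (∀ i → i < n → ¬ P i) ⊎ (∃ λ m → P m × (∀ i → i < m → ¬ P i))
  least-below P zero    = inj₁ λ _ ()
  least-below P (suc n) with least-below P n | em {P n}
  ... | inj₂ m   | _     = inj₂ m
  ... | inj₁ ¬P  | yes p = inj₂ (n , p , ¬P)
  ... | inj₁ ¬P  | no ¬p = inj₁ λ i i<1+n →
    [ ¬P i , (λ where refl → ¬p) ]′ (m<1+n⇒m<n∨m≡n i<1+n)

  least : ∀ (P : ℕ → Set) → ∃ P → ∃ λ m → P m × (∀ i → i < m → ¬ P i)
  least P (n , p) = [ (λ ¬P → ⊥-elim (¬P n ≤-refl p)) , id ]′ (least-below P (suc n))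

  counterexample : ∀ (P : ℕ → Set) → ¬ (∀ t → P t) → ∃ λ t → ¬ P t
  counterexample P ¬P with em {∃ λ t → ¬ P t}
  ... | yes w = w
  ... | no ¬w = ⊥-elim (¬P λ t → decidable-stable em λ ¬p → ¬w (t , ¬p))

  module _ {A : Pred ℕ 0ℓ} where
    open Recursive {A} (λ _ → em) public
    open RecursiveIn {A} (λ _ → em) public

  haltsᶠ : ∀ {A k} → Program → Term {A ′} k → Formula {A ′} k
  haltsᶠ {A} c t = asᶠ (oracleᶠ (callᵗ c t)) (λ ρ → ∃ (⟦ c ⟧ A (val t ρ)))
    (λ ρ → to (′-call c (val t ρ))) (λ ρ → from (′-call c (val t ρ)))

  witness-search : ∀ {A} (φ : Formula {A} 2) x →
                   ∃ (⟦ search φ ⟧ A x) ⇔ (∃ λ t → ¬ holds φ (x ∷ t ∷ []))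
  witness-search φ x = mk⇔
    (λ (t , p) → t , proj₁ (to (search-halts φ x t) p))
    (λ p → let t , q , below = least _ p in
      t , from (search-halts φ x t) (q , λ i i<t → decidable-stable em (below i i<t)))

  -- A single A-program, given `⟨ x , m ⟩`, searches for a t at which the value exceeds m; whether
  -- it halts is one query to A′.
  exceedsᶠ : ∀ {A} → Term {A} 2 → Formula {A ′} 2
  exceedsᶠ {A} F = asᶠ (haltsᶠ (search bounded) ⟨ var 0F , var 1F ⟩ᵗ)
    (λ ρ → ∃ λ t → ¬ (val F (head ρ ∷ t ∷ []) ≤ head (tail ρ)))
    (λ where
      (x ∷ m ∷ []) h →
        let t , p = to (witness-search bounded ⟨ x , m ⟩) h in t , subst id (at x m t) p)
    (λ where
      (x ∷ m ∷ []) (t , p) →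
        from (witness-search bounded ⟨ x , m ⟩) (t , subst id (sym (at x m t)) p))
    where
    bounded : Formula {A} 2
    -- The substituted values are m, x and t, in this order.
    bounded = (↑ F ≤ᶠ var 0F) [ π₂ᵗ (var 0F) ∷ π₁ᵗ (var 0F) ∷ var 1F ∷ [] ]

    at : ∀ x m t → (¬ holds bounded (⟨ x , m ⟩ ∷ t ∷ [])) ≡ (¬ (val F (x ∷ t ∷ []) ≤ m))
    at x m t = cong (λ (x , m) → ¬ (val F (x ∷ t ∷ []) ≤ m)) (unpair-⟨⟩ x m)

  -- φ is a variable here because the program of exceedsᶠ F contains a code that
  -- is far too large to be evaluated.
  search-IsMax : ∀ {B} (φ : Formula {B} 2) (h : ℕ → ℕ → ℕ) →
    (∀ x m → holds φ (x ∷ m ∷ []) ⇔ (∃ λ t → ¬ (h x t ≤ m))) →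
    ∃ λ c → ∀ x m → ⟦ c ⟧ B x m ⇔ IsMax (h x) m
  search-IsMax φ h exceeds = search φ , λ x m → mk⇔
    (λ p → let bounded , below = to (search-halts φ x m) p
               upper = λ t → decidable-stable (h x t ≤? m)
                               (λ h≰m → bounded (from (exceeds x m) (t , h≰m)))
           in  attained x m upper (λ i i<m → to (exceeds x i) (below i i<m)) , upper)
    (λ ((t , eq) , upper) → from (search-halts φ x m)
      ((λ p → let u , h≰m = to (exceeds x m) p in h≰m (upper u)) ,
       λ i i<m → from (exceeds x i) (t , λ h≤i → <⇒≱ i<m (subst (_≤ i) eq h≤i))))
    where
    attained : ∀ x m → (∀ t → h x t ≤ m) → (∀ i → i < m → ∃ λ t → ¬ (h x t ≤ i)) →
               ∃ λ t → h x t ≡ m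
    -- If the bound is 0, any argument attains it, such as 0. If it is m + 1, some value exceeds m
    -- and so equals the bound.
    attained x zero    upper below = 0 , n≤0⇒n≡0 (upper 0)
    attained x (suc m) upper below =
      let t , h≰m = below m ≤-refl in t , ≤-antisym (upper t) (≰⇒> h≰m)

  -- `pair` is strict, so the composite halts exactly if both programs do, just as a difference is
  -- defined iff both its terms are.
  difference-program : ∀ {B} (P Q : ℕ → ℕ → Set) →
    (∃ λ c → ∀ x m → ⟦ c ⟧ B x m ⇔ P x m) → (∃ λ d → ∀ x n → ⟦ d ⟧ B x n ⇔ Q x n) →
    ∃ λ e → ∀ x y → ⟦ e ⟧ B x y ⇔
      (∃ λ m → ∃ λ n → P x m × Q x n × y ≡ codeℤ (+ m - + n))
  difference-program {B} P Q (c , c-P) (d , d-Q) = difference (code D) λ m n →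
    subst (⟦ code D ⟧ B (env (m ∷ n ∷ []))) (codeDifference-codeℤ m n) (halts (runs D (m ∷ n ∷ [])))
    where
    D : Term {B} 2
    D = codeDifferenceᵗ (var 0F) (var 1F)

    difference : ∀ e → (∀ m n → ⟦ e ⟧ B (env (m ∷ n ∷ [])) (codeℤ (+ m - + n))) →
      ∃ λ e → ∀ x y → ⟦ e ⟧ B x y ⇔
        (∃ λ m → ∃ λ n → P x m × Q x n × y ≡ codeℤ (+ m - + n))
    difference e e-runs = comp e (pair c (pair d zero)) , λ x y → mk⇔
      (λ where
        (_ , (m , _ , p , (n , _ , q , refl , refl) , refl) , r) →
          m , n , to (c-P x m) p , to (d-Q x n) q ,
          deterministic e {env (m ∷ n ∷ [])} r (e-runs m n))
      (λ (m , n , p , q , eq) →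
        env (m ∷ n ∷ []) ,
        (m , _ , from (c-P x m) p , (n , 0 , from (d-Q x n) q , refl , refl) , refl) ,
        subst (⟦ e ⟧ B (env (m ∷ n ∷ []))) (sym eq) (e-runs m n))

  max-difference : ∀ {A} (F G : Term {A} 2) → ∃ λ c → ∀ x y → ⟦ c ⟧ (A ′) x y ⇔
    (∃ λ m → ∃ λ n → IsMax (λ t → val F (x ∷ t ∷ [])) m × IsMax (λ t → val G (x ∷ t ∷ [])) n ×
      y ≡ codeℤ (+ m - + n))
  max-difference {A} F G = difference-program _ _ (max F) (max G)
    where
    max : (F : Term {A} 2) → ∃ λ c → ∀ x m → ⟦ c ⟧ (A ′) x m ⇔ IsMax (λ t → val F (x ∷ t ∷ [])) m
    max F = search-IsMax (exceedsᶠ F) (λ x t → val F (x ∷ t ∷ [])) (λ x m → mk⇔ id id)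

  -- Enumerating the jump, and the graphs of A′-recursive functions

  oracle-ruleᶠ : ∀ {A} → Formula {A} 4
  oracle-ruleᶠ = (oracleᶠ (var 0F) ∧ var 1F ≡ᶠ # 1) ∨ (~ oracleᶠ (var 0F) ∧ var 1F ≡ᶠ # 0)

  module _ {A : Pred ℕ 0ℓ} where
    open Certificates {A} (λ _ → em) public

  -- The second argument encodes an output and two certificates.
  haltingᶠ : ∀ {A} → Formula {A} 2
  haltingᶠ = certifiesᶠ oracle-ruleᶠ (π₁ᵗ (π₂ᵗ (var 1F))) (# 0) (program-factᵗ (var 0F)) ∧
             certifiesᶠ oracle-ruleᶠ (π₂ᵗ (π₂ᵗ (var 1F))) (# 0)
               (halting-factᵗ (var 0F) (var 0F) (π₁ᵗ (var 1F)))

  -- The rules with oracle A are decidable in A, so finite certificates enumerate A′. One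
  -- certificate shows that e is a Gödel number, as otherwise the halting fact would hold vacuously.
  haltingᶠ-′ : ∀ {A} e → (A ′) e ⇔ (∃ λ s → holds (haltingᶠ {A}) (e ∷ s ∷ []))
  haltingᶠ-′ {A} e = mk⇔ forwards backwards
    where
    O : ℕ → ℕ → ℕ → ℕ → Set
    O b t x y = holds (oracle-ruleᶠ {A}) (x ∷ y ∷ b ∷ t ∷ [])

    open Soundness A
    open Completeness A O

    backwards : (∃ λ s → holds (haltingᶠ {A}) (e ∷ s ∷ [])) → (A ′) e
    backwards (s , p , q) =
      let c , eq = Fact-program e (Certifies-sound A O (λ r → r 0) {π₁ (π₂ s)} {program-fact e} (λ _ → p))
      in  c , eq , π₁ s , Fact-halting c (sym eq) 
             (Certifies-sound A O (λ r → r 0) {π₂ (π₂ s)} {halting-fact e e (π₁ s)} (λ _ → q))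

    forwards : (A ′) e → ∃ λ s → holds (haltingᶠ {A}) (e ∷ s ∷ [])
    forwards (c , eq , y , p) = combine
      (Certifies-complete A O (program-derivable c e (sym eq)))
      (Certifies-complete A O (halting-derivable (λ o → 0 , λ _ _ → o) c e e y (sym eq) p))
      where
      combine : (∃ λ u → ∀ t → Certifies O u t (program-fact e)) →
                (∃ λ v → ∀ t → Certifies O v t (halting-fact e e y)) →
                ∃ λ s → holds (haltingᶠ {A}) (e ∷ s ∷ [])
      combine (u , cert-u) (v , cert-v) = ⟨ y , ⟨ u , v ⟩ ⟩ , decode-triple {y} {u} {v}
        (λ y u v → Certifies O u 0 (program-fact e) × Certifies O v 0 (halting-fact e e y))
        (cert-u 0 , cert-v 0)

  module Enumerable {A B : Pred ℕ 0ℓ} (φ : Formula {A} 2)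
                    (enumerates : ∀ x → B x ⇔ (∃ λ s → holds φ (x ∷ s ∷ []))) where

    -- A positive answer of B is witnessed within the bound; that no witness
    -- contradicts a negative one is tested at every stage t.
    answerᶠ : Formula {A} 4
    answerᶠ = (var 1F ≡ᶠ # 1 ∧ any< (var 2F) (φ [ var 1F ∷ var 0F ∷ [] ])) ∨
              (var 1F ≡ᶠ # 0 ∧ ~ φ [ var 0F ∷ var 3F ∷ [] ])

    O : ℕ → ℕ → ℕ → ℕ → Set
    O b t x y = holds answerᶠ (x ∷ y ∷ b ∷ t ∷ [])

    open Soundness B
    open Completeness B O

    -- Stage 0 reveals which answer is claimed, and a witness s against a negative answer is
    -- detected at stage s.
    O-sound : ∀ {b x y} → (∀ t → O b t x y) → ⟦ oracle ⟧ B x y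
    O-sound {b} {x} {y} o with o 0
    ... | inj₁ (y≡1 , s , _ , p) = inj₁ (from (enumerates x) (s , p) , y≡1)
    ... | inj₂ (y≡0 , _) = inj₂ ((λ a → let s , p = to (enumerates x) a in refute s p (o s)) , y≡0)
      where
      refute : ∀ s → holds φ (x ∷ s ∷ []) → O b s x y → ⊥
      refute s p (inj₁ (y≡1 , _)) = 0≢1+n (trans (sym y≡0) y≡1)
      refute s p (inj₂ (_ , ¬p))  = ¬p p

    O-complete : ∀ {x y} → ⟦ oracle ⟧ B x y → ∃ λ b → ∀ {b′} → b ≤ b′ → ∀ t → O b′ t x y
    O-complete {x} (inj₁ (a , y≡1)) = let s , p = to (enumerates x) a in
      suc s , λ s< t → inj₁ (y≡1 , s , s< , p)
    O-complete {x} (inj₂ (¬a , y≡0)) =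
      0 , λ _ t → inj₂ (y≡0 , λ p → ¬a (from (enumerates x) (t , p)))

    -- Soundness and completeness together put the graph of any program with oracle B in Σ₂ form
    -- relative to A.
    graph : ∀ c x y → ⟦ c ⟧ B x y ⇔ (∃ λ w → ∀ t → Certifies O w t (halting-fact ⌜ c ⌝ x y))
    graph c x y = mk⇔
      (λ p → Certifies-complete B O {halting-fact ⌜ c ⌝ x y}
        (halting-derivable O-complete c ⌜ c ⌝ x y refl p))
      (λ (w , p) → Fact-halting c {⌜ c ⌝} {x} {y} refl
        (Certifies-sound B O O-sound {w} {halting-fact ⌜ c ⌝ x y} p))

  -- w encodes m, n and a certificate that the output codes the integer m - n.
  limit-graph : ∀ {A} c → Σ (Formula {A} 3) λ ψ → ∀ x z → ⟦ c ⟧ (A ′) x (codeℤ z) ⇔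
    (∃ λ w → (∀ t → holds ψ (x ∷ w ∷ t ∷ [])) × z ≡ + π₁ w - + π₁ (π₂ w))
  limit-graph {A} c = from-enumeration haltingᶠ haltingᶠ-′
    where
    from-enumeration : (φ : Formula {A} 2) →
      (∀ x → (A ′) x ⇔ (∃ λ s → holds φ (x ∷ s ∷ []))) →
      Σ (Formula {A} 3) λ ψ → ∀ x z → ⟦ c ⟧ (A ′) x (codeℤ z) ⇔
        (∃ λ w → (∀ t → holds ψ (x ∷ w ∷ t ∷ [])) × z ≡ + π₁ w - + π₁ (π₂ w))
    from-enumeration φ enumerates = ψ , λ x z → mk⇔ (forwards x z) (backwards x z)
      where
      open Enumerable {A} {A ′} φ enumerates

      outputᵗ : Term {A} 3
      outputᵗ = as (codeDifferenceᵗ (π₁ᵗ (var 1F)) (π₁ᵗ (π₂ᵗ (var 1F))))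
        (λ ρ → let w = head (tail ρ) in codeℤ (+ π₁ w - + π₁ (π₂ w)))
        (λ ρ → let w = head (tail ρ) in codeDifference-codeℤ (π₁ w) (π₁ (π₂ w)))

      ψ : Formula {A} 3
      ψ = certifiesᶠ answerᶠ (π₂ᵗ (π₂ᵗ (var 1F))) (var 2F)
            (halting-factᵗ (# ⌜ c ⌝) (var 0F) outputᵗ)

      forwards : ∀ x z → ⟦ c ⟧ (A ′) x (codeℤ z) →
        ∃ λ w → (∀ t → holds ψ (x ∷ w ∷ t ∷ [])) × z ≡ + π₁ w - + π₁ (π₂ w)
      forwards x z p = encoded (as-difference z) (to (graph c x (codeℤ z)) p)
        where
        as-difference : ∀ z → ∃ λ m → ∃ λ n → z ≡ + m - + n
        as-difference (+ m)    = m , 0 , sym (ℤ.+-identityʳ (+ m))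
        as-difference -[1+ n ] = 0 , suc n , refl

        encoded : (∃ λ m → ∃ λ n → z ≡ + m - + n) →
          (∃ λ v → ∀ t → Certifies O v t (halting-fact ⌜ c ⌝ x (codeℤ z))) →
          ∃ λ w → (∀ t → holds ψ (x ∷ w ∷ t ∷ [])) × z ≡ + π₁ w - + π₁ (π₂ w)
        encoded (m , n , eq) (v , certified) = ⟨ m , ⟨ n , v ⟩ ⟩ , decode-triple {m} {n} {v}
          (λ m n v → (∀ t → Certifies O v t (halting-fact ⌜ c ⌝ x (codeℤ (+ m - + n)))) × z ≡ + m - + n)
          (subst (λ z → ∀ t → Certifies O v t (halting-fact ⌜ c ⌝ x (codeℤ z))) eq certified , eq)

      backwards : ∀ x z → (∃ λ w → (∀ t → holds ψ (x ∷ w ∷ t ∷ [])) × z ≡ + π₁ w - + π₁ (π₂ w)) →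
                  ⟦ c ⟧ (A ′) x (codeℤ z)
      backwards x z (w , certified , refl) =
        from (graph c x (codeℤ z)) (π₂ (π₂ w) , certified)

  -- Functions whose maximum marks the least correct candidate

  module Approximation {A : Pred ℕ 0ℓ} (ψ : Formula {A} 3) (U : Term {A} 2) (v : ℕ → ℕ)
                       (U-val : ∀ x t → val U (x ∷ t ∷ []) ≡ v (π₁ t)) (v≤ : ∀ w → v w ≤ w) where

    Correct : ℕ → ℕ → Set
    Correct x w = ∀ t → holds ψ (x ∷ w ∷ t ∷ [])

    -- At stage t = ⟨ w , b ⟩ every candidate below w has been refuted by time b.
    refutedᶠ : Formula {A} 2
    refutedᶠ = all< (π₁ᵗ (var 1F)) (any< (↑ π₂ᵗ (var 1F)) (~ ψ [ var 2F ∷ var 1F ∷ var 0F ∷ [] ]))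

    Refuted : ℕ → ℕ → ℕ → Set
    Refuted x w b = ∀ i → i < w → ∃ λ t → t < b × ¬ holds ψ (x ∷ i ∷ t ∷ [])

    -- Adding w * w makes the values increase with w, as v w ≤ w.
    value : ℕ → ℕ
    value w = w * w + v w

    -- A stage that has not yet refuted all smaller candidates yields the default 0, which never
    -- raises the maximum.
    approximationᵗ : Term {A} 2
    approximationᵗ = ifᵗ refutedᶠ (π₁ᵗ (var 1F) *ᵗ π₁ᵗ (var 1F) +ᵗ U) (# 0)

    h : ℕ → ℕ → ℕ
    h x t = val approximationᵗ (x ∷ t ∷ [])

    h-cases : ∀ x t → (Refuted x (π₁ t) (π₂ t) × h x t ≡ value (π₁ t)) ⊎
                      ((¬ Refuted x (π₁ t) (π₂ t)) × h x t ≡ 0)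
    h-cases x t = Sum.map₁
      (λ (r , eq) → r , trans eq (cong (λ u → π₁ t * π₁ t + u) (U-val x t)))
      (ifᵗ-cases refutedᶠ (π₁ᵗ (var 1F) *ᵗ π₁ᵗ (var 1F) +ᵗ U) (# 0) (x ∷ t ∷ []))

    -- The gap between w * w and the next square absorbs `v w`.
    value-increasing : ∀ {w w′} → w < w′ → value w ≤ value w′
    value-increasing {w} {w′} w<w′ = begin
      w * w + v w      ≤⟨ +-monoʳ-≤ (w * w) (v≤ w) ⟩
      w * w + w        ≡⟨ +-comm (w * w) w ⟩
      suc w * w        ≤⟨ *-mono-≤ w<w′ (<⇒≤ w<w′) ⟩
      w′ * w′          ≤⟨ m≤m+n (w′ * w′) (v w′) ⟩
      w′ * w′ + v w′   ∎
      where open ≤-Reasoning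

    -- Only finitely many candidates lie below w, so a common time b refutes them all, and stage
    -- `⟨ w , b ⟩` has the value.
    value-attained : ∀ x w → (∀ i → i < w → ¬ Correct x i) → ∃ λ t → h x t ≡ value w
    value-attained x w none = attained (bound-witnesses w λ i i<w → counterexample (λ t → holds ψ (x ∷ i ∷ t ∷ [])) (none i i<w))
      where
      attained : (∃ λ b → Refuted x w b) → ∃ λ t → h x t ≡ value w
      attained (b , r) = ⟨ w , b ⟩ , [ (λ (_ , eq) → trans eq (cong value (π₁-⟨⟩ w b))) ,
        (λ (¬r , _) → ⊥-elim (¬r (subst₂ (Refuted x) (sym (π₁-⟨⟩ w b)) (sym (π₂-⟨⟩ w b)) r))) ]′
        (h-cases x ⟨ w , b ⟩)

    least-IsMax : ∀ x w → Correct x w → (∀ i → i < w → ¬ Correct x i) → IsMax (h x) (value w)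
    least-IsMax x w correct none = value-attained x w none , upper
      where
      value≤ : ∀ u b → Refuted x u b → value u ≤ value w
      value≤ u b r with <-cmp u w
      ... | tri< u<w _ _  = value-increasing u<w
      ... | tri≈ _ refl _ = ≤-refl
      -- A candidate above w would need a refutation of w, which is correct.
      ... | tri> _ _ w<u  = let t , _ , ¬p = r w w<u in ⊥-elim (¬p (correct t))

      upper : ∀ t → h x t ≤ value w
      upper t = [ (λ (r , eq) → subst (_≤ value w) (sym eq) (value≤ (π₁ t) (π₂ t) r)) ,
                  (λ (_ , eq) → subst (_≤ value w) (sym eq) z≤n) ]′ (h-cases x t)

    IsMax-correct : ∀ x {m} → IsMax (h x) m → ∃ (Correct x)
    IsMax-correct x {m} (_ , upper) = decidable-stable em λ none →
      -- Without a correct candidate even the value of m + 1 is attained, and it is at least (m + 1)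
      -- * (m + 1), hence above m.
      let t , eq = value-attained x (suc m) (λ i _ p → none (i , p))
      in  <-irrefl refl (≤-trans (m≤m+n (suc m) _)
            (≤-trans (m≤m+n (suc m * suc m) (v (suc m))) (subst (_≤ m) eq (upper t))))

  -- Both approximations test candidates with the same `ψ`, so their maxima belong to the same least
  -- w, and w * w cancels in the difference.
  jump-recursive⇒max-difference : ∀ {A} c → ∃ λ (F : Term {A} 2) → ∃ λ (G : Term {A} 2) →
    ∀ x z → ⟦ c ⟧ (A ′) x (codeℤ z) ⇔
      (∃ λ m → ∃ λ n → IsMax (λ t → val F (x ∷ t ∷ [])) m × IsMax (λ t → val G (x ∷ t ∷ [])) n ×
        z ≡ + m - + n)
  jump-recursive⇒max-difference {A} c = from-limit (limit-graph {A} c)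
    where
    MaxDifference : Term {A} 2 → Term {A} 2 → ℕ → ℤ → Set
    MaxDifference F G x z = ∃ λ m → ∃ λ n →
      IsMax (λ t → val F (x ∷ t ∷ [])) m × IsMax (λ t → val G (x ∷ t ∷ [])) n × z ≡ + m - + n

    from-limit : (Σ (Formula {A} 3) λ ψ → ∀ x z → ⟦ c ⟧ (A ′) x (codeℤ z) ⇔
        (∃ λ w → (∀ t → holds ψ (x ∷ w ∷ t ∷ [])) × z ≡ + π₁ w - + π₁ (π₂ w))) →
      ∃ λ F → ∃ λ G → ∀ x z → ⟦ c ⟧ (A ′) x (codeℤ z) ⇔ MaxDifference F G x z
    from-limit (ψ , graph) = P.approximationᵗ , N.approximationᵗ , λ x z → mk⇔
      (λ p → let w , correct , _ = to (graph x z) p in forwards x z p (least (P.Correct x) (w , correct)))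
      (λ (m , n , m-max , n-max , eq) →
        backwards x z m-max n-max eq (least (P.Correct x) (P.IsMax-correct x m-max)))
      where
      module P = Approximation {A} ψ (π₁ᵗ (π₁ᵗ (var 1F))) π₁ (λ _ _ → refl) π₁≤
      module N = Approximation {A} ψ (π₁ᵗ (π₂ᵗ (π₁ᵗ (var 1F)))) (π₁ ∘ π₂) (λ _ _ → refl)
                   (λ w → ≤-trans (π₁≤ (π₂ w)) (π₂≤ w))

      difference : ∀ w → + P.value w - + N.value w ≡ + π₁ w - + π₁ (π₂ w)
      difference w = trans (ℤ.m-n≡m⊖n (P.value w) (N.value w))
        (trans (ℤ.+-cancelˡ-⊖ (w * w) (π₁ w) (π₁ (π₂ w))) (sym (ℤ.m-n≡m⊖n (π₁ w) (π₁ (π₂ w)))))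

      Least : ℕ → Set
      Least x = ∃ λ w → P.Correct x w × (∀ i → i < w → ¬ P.Correct x i)

      forwards : ∀ x z → ⟦ c ⟧ (A ′) x (codeℤ z) → Least x →
                 MaxDifference P.approximationᵗ N.approximationᵗ x z
      forwards x z p (w , correct , none) =
        P.value w , N.value w , P.least-IsMax x w correct none , N.least-IsMax x w correct none ,
        -- The least correct candidate may differ from the one supplied by the computation of z, but
        -- by determinism it encodes the same integer.
        trans (codeℤ-injective
                (deterministic c p (from (graph x (+ π₁ w - + π₁ (π₂ w))) (w , correct , refl))))
              (sym (difference w))

      backwards : ∀ x z {m n} → IsMax (P.h x) m → IsMax (N.h x) n → z ≡ + m - + n → Least x →
                  ⟦ c ⟧ (A ′) x (codeℤ z)
      backwards x z m-max n-max eq (w , correct , none) = from (graph x z) (w , correct ,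
        trans eq (trans (cong₂ (λ m n → + m - + n)
          (IsMax-unique m-max (P.least-IsMax x w correct none))
          (IsMax-unique n-max (N.least-IsMax x w correct none))) (difference w)))

-- Both directions for functions on words

theorem1p6 : ExcludedMiddle 0ℓ →
    (A : Pred ℕ 0ℓ) (G : Word → Maybe ℤ) →
    PartialRecursiveIn (A ′) G
    ⇔
    (∃ λ (f : Word × ℕ → ℕ) → ∃ λ (g : Word × ℕ → ℕ) →
    TotalRecursiveIn A f × TotalRecursiveIn A g ×
    (∀ p z →
    (G p ≡ just z)
    ⇔
    (∃ λ m → ∃ λ n →
    IsMax (λ t → f (p , t)) m × IsMax (λ t → g (p , t)) n × z ≡ + m - + n)))
theorem1p6 em A G = mk⇔
  (λ (c , correct) →
    let F , H , graph = jump-recursive⇒max-difference {A} c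
    in  _ , _ , val-recursive F , val-recursive H , λ p z → mk⇔
          (λ eq → to (graph (codeWord p) z) (from (correct p _) (cong (Maybe.map codeℤ) eq)))
          (λ d → map-injective codeℤ-injective (to (correct p _) (from (graph (codeWord p) z) d))))
  (λ (f , g , f-rec , g-rec , maxima) →
    let F , F≡f = recursive-val f f-rec
        H , H≡g = recursive-val g g-rec
        c , graph = max-difference F H
    in  c , λ p y → mk⇔
          -- Any output y of this program is the code of a difference of maxima, which is the value
          -- of G at p.
          (λ r → let m , n , m-max , n-max , eq = to (graph (codeWord p) y) r in
            trans (cong (Maybe.map codeℤ) (from (maxima p (+ m - + n))
                    (m , n , IsMax-cong (F≡f p) m-max , IsMax-cong (H≡g p) n-max , refl)))
                  (cong just (sym eq)))
          (λ eq → let z , Gp≡ , y≡ = map-just (G p) eq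
                      m , n , m-max , n-max , z≡ = to (maxima p z) Gp≡
                  in  from (graph (codeWord p) y)
                        (m , n , IsMax-cong (λ t → sym (F≡f p t)) m-max ,
                         IsMax-cong (λ t → sym (H≡g p t)) n-max , trans y≡ (cong codeℤ z≡))))
  where
  open Classical em

  map-just : ∀ (i : Maybe ℤ) {y} → Maybe.map codeℤ i ≡ just y → ∃ λ z → i ≡ just z × y ≡ codeℤ z
  map-just (just z) refl = z , refl , refl
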